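{- Let $\phi(n)$ and $\psi(n)$ be growing functions (which may grow arbitrarily slowly) such that $\phi(n) \leq n/(\log_2 n + \log_2 \psi(n))$. If $q_0 = q_0(n) \sim n\,2^{\,n-\lceil n/\phi(n)\rceil}$ as $n \to \infty$, then $L(n,q_0) \lesssim 2^n$.
   Context: Let $\mathbb B=\{0,1\}$. For a set $I=\{i_1,\dots,i_k\}\subseteq\{1,\dots,m\}$ and $t\in\{1,\dots,m\}\setminus I$, the generalized Toffoli gate $TOF(I;t)$ on $m$ lines is the gate defining the map $\mathbb B^m\to\mathbb B^m$ which replaces $x_t$ by $x_t\oplus (x_{i_1}\wedge\cdots\wedge x_{i_k})$ and leaves the other coordinates unchanged (for $k=0$, it is the NOT gate $x_t\mapsto x_t\oplus 1$). $\Omega_m^2$ is the set of all such gates on $m$ lines with $k\le 2$, i.e. all NOT ($k=0$), CNOT ($k=1$) and C$^2$NOT ($k=2$) gates. A reversible circuit $\mathfrak S$ with $m$ inputs is a finite sequence (composition) of gates from $\Omega_m^2$, all acting on the same $m$ numbered lines. Its gate complexity $L(\mathfrak S)$ is its number of gates. A circuit with $n+q$ inputs implements $f\colon\mathbb B^n\to\mathbb B^r$ with $q$ additional inputs if there is a permutation $\pi$ of the $n+q$ output lines such that for every $x\in\mathbb B^n$ the input $\langle x_1,\dots,x_n,0,\dots,0\rangle$ is transformed by the circuit, after applying $\pi$ to the outputs, into $\langle y_1,\dots,y_r,*,\dots,*\rangle$ with $f(\langle x_1,\dots,x_n\rangle)=\langle y_1,\dots,y_r\rangle$; the outputs marked $*$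 are arbitrary (computational garbage is allowed). $F(n,q)$ is the set of all transformations $\mathbb B^n\to\mathbb B^n$ that can be implemented by reversible circuits with $n+q$ inputs (gates from $\Omega_{n+q}^2$). For $f\in F(n,q)$, $L(f,q)$ is the minimum of $L(\mathfrak S)$ over all reversible circuits $\mathfrak S$ implementing $f$ with $q$ additional inputs, and $L(n,q)=\max_{f\in F(n,q)}L(f,q)$. Asymptotics are for $n\to\infty$: $a(n)\sim b(n)$ means $a(n)/b(n)\to1$; $a(n)\lesssim b(n)$ means $\limsup a(n)/b(n)\le 1$. A growing function is one tending to infinity; inequalities between functions of $n$ are required for all sufficiently large $n$. -}

module Defs where

open import Data.Bool.Base using (Bool; true; false; not; _∧_; _∨_; _xor_)
import Data.Bool.Properties as Bool
open import Data.Fin.Base as Fin using (Fin; zero; suc; toℕ; combine; remQuot; funToFin; finToFun)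
import Data.Fin.Properties as Fin
open import Data.Fin.Permutation using (Permutation′; permutation; _⟨$⟩ʳ_; _⟨$⟩ˡ_; inverseˡ; inverseʳ)
import Data.Fin.Permutation as Perm
open import Data.Fin.Subset using (Subset; ∣_∣; _∉_)
open import Data.Fin.Subset.Properties using (anySubset?; _∈?_)
open import Data.Integer.Base as ℤ using (ℤ; +_; -[1+_])
import Data.Integer.Properties as ℤ
open import Data.List.Base as List using (List; []; _∷_; length; _++_)
import Data.List.Properties as List
open import Data.Nat.Base as ℕ using (ℕ; zero; suc; s≤s; z≤n)
import Data.Nat.Coprimality as C
import Data.Nat.Properties as ℕ
open import Data.Product.Base using (∃; Σ; Σ-syntax; ∃-syntax; _×_; _,_; proj₁; proj₂)
open import Data.Rational as ℚ using (ℚ; mkℚ; 0ℚ; 1ℚ; ½; ↥_; ↧ₙ_)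
import Data.Rational.Properties as ℚ
open import Data.Vec.Base as Vec using (Vec; []; _∷_)
import Data.Vec.Properties as Vec
open import Function.Base using (_∘_)
open import Relation.Binary.Definitions using (tri<; tri≈; tri>)
open import Relation.Binary.PropositionalEquality
open import Relation.Nullary using (¬_; Dec; yes; no; contradiction; recompute; _×-dec_; ¬?)
open import Relation.Nullary.Decidable using (map′; decidable-stable)
open import Algebra.Bundles using (CommutativeRing)
open import Algebra.Definitions.RawSemiring ℚ.+-*-rawSemiring using (_^_)
import Algebra.Properties.Semiring.Exp (CommutativeRing.semiring ℚ.+-*-commutativeRing) as Exp

-- Textbook Dedekind cuts: a real is identified with the set of rationals
-- strictly below it.  Locatedness is not demanded; classically it is automatic.
record ℝ : Set₁ where
  field
    lower      : ℚ → Set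
    inhabited  : ∃ lower
    bounded    : ∃ λ b → ¬ lower b
    downwards  : ∀ {p q} → p ℚ.< q → lower q → lower p
    rounded    : ∀ {p} → lower p → ∃ λ q → p ℚ.< q × lower q

open ℝ public

infix 4 _≤ᴿ_ _<ᴿ_

_≤ᴿ_ : ℝ → ℝ → Set
x ≤ᴿ y = ∀ {r} → lower x r → lower y r

_<ᴿ_ : ℝ → ℝ → Set
x <ᴿ y = ∃ λ r → lower y r × ¬ lower x r

Positive : ℝ → Set
Positive x = lower x 0ℚ

module _ (x : ℝ) where

  below-bound : ∀ {a b} → lower x a → ¬ lower x b → a ℚ.< b
  below-bound {a} {b} a∈ b∉ with ℚ.<-cmp a b
  ... | tri< a<b _ _    = a<b
  ... | tri≈ _ refl _   = contradiction a∈ b∉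
  ... | tri> _ _ b<a    = contradiction (downwards x b<a a∈) b∉

private
  +1-< : ∀ p → p ℚ.< p ℚ.+ 1ℚ
  +1-< p = subst (ℚ._< p ℚ.+ 1ℚ) (ℚ.+-identityʳ p) (ℚ.+-monoʳ-< p (ℚ.positive⁻¹ 1ℚ))

  -1-< : ∀ p → p ℚ.- 1ℚ ℚ.< p
  -1-< p = subst (p ℚ.- 1ℚ ℚ.<_) (ℚ.+-identityʳ p) (ℚ.+-monoʳ-< p (ℚ.negative⁻¹ (ℚ.- 1ℚ)))

fromℚ : ℚ → ℝ
fromℚ q = record
  { lower     = ℚ._< q
  ; inhabited = q ℚ.- 1ℚ , -1-< q
  ; bounded   = q , ℚ.<-irrefl refl
  ; downwards = ℚ.<-trans
  ; rounded   = λ p<q → let r , p<r , r<q = ℚ.<-dense p<q in r , p<r , r<q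
  }

fromℤ : ℤ → ℝ
fromℤ k = fromℚ (k ℚ./ 1)

fromℕ : ℕ → ℝ
fromℕ n = fromℤ (+ n)

infixl 6 _+ᴿ_

_+ᴿ_ : ℝ → ℝ → ℝ
x +ᴿ y = record
  { lower     = λ r → ∃[ a ] ∃[ b ] lower x a × lower y b × r ℚ.< a ℚ.+ b
  ; inhabited = let a , a∈ = inhabited x ; b , b∈ = inhabited y
                in (a ℚ.+ b) ℚ.- 1ℚ , a , b , a∈ , b∈ , -1-< (a ℚ.+ b)
  ; bounded   = let s , s∉ = bounded x ; t , t∉ = bounded y
                in s ℚ.+ t , λ (_ , _ , a∈ , b∈ , lt) →
                     ℚ.<-asym lt (ℚ.+-mono-< (below-bound x a∈ s∉) (below-bound y b∈ t∉))
  ; downwards = λ p<q (a , b , a∈ , b∈ , lt) → a , b , a∈ , b∈ , ℚ.<-trans p<q lt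
  ; rounded   = λ (a , b , a∈ , b∈ , lt) → let r , p<r , r<ab = ℚ.<-dense lt
                in r , p<r , a , b , a∈ , b∈ , r<ab
  }

private
  module _ {b : ℚ} (b>0 : 0ℚ ℚ.< b) where
    instance
      b-pos : ℚ.Positive b
      b-pos = ℚ.positive b>0
      b-nz : ℚ.NonZero b
      b-nz = ℚ.pos⇒nonZero b

    inv : ℚ
    inv = ℚ.1/ b

    *inv* : ∀ t → (t ℚ.* inv) ℚ.* b ≡ t
    *inv* t = trans (ℚ.*-assoc t inv b)
                    (trans (cong (t ℚ.*_) (ℚ.*-inverseˡ b)) (ℚ.*-identityʳ t))

    *-monoˡ-< : ∀ {p q} → p ℚ.< q → p ℚ.* b ℚ.< q ℚ.* b
    *-monoˡ-< = ℚ.*-monoˡ-<-pos b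

    inv-> : ∀ {p t} → p ℚ.* b ℚ.< t → p ℚ.< t ℚ.* inv
    inv-> {p} {t} lt = ℚ.*-cancelʳ-<-nonNeg b {{ℚ.pos⇒nonNeg b}}
                         (subst (p ℚ.* b ℚ.<_) (sym (*inv* t)) lt)

  *-mono-≤ : ∀ {a b c d} → 0ℚ ℚ.≤ a → 0ℚ ℚ.≤ d → a ℚ.≤ b → c ℚ.≤ d → a ℚ.* c ℚ.≤ b ℚ.* d
  *-mono-≤ {a} {b} {c} {d} 0≤a 0≤d a≤b c≤d = ℚ.≤-trans
    (ℚ.*-monoˡ-≤-nonNeg a {{ℚ.nonNegative 0≤a}} c≤d)
    (ℚ.*-monoʳ-≤-nonNeg d {{ℚ.nonNegative 0≤d}} a≤b)

  ι : ℕ → ℚ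
  ι k = + k ℚ./ 1

  ι≡ : ∀ k → ι k ≡ mkℚ (+ k) 0 (C.sym (C.1-coprimeTo k))
  ι≡ k = ℚ.normalize-coprime (C.sym (C.1-coprimeTo k))

  0≤ι : ∀ k → 0ℚ ℚ.≤ ι k
  0≤ι k rewrite ι≡ k = ℚ.nonNegative⁻¹ _

-- r < n / y iff r · b < n for some rational b ≥ y; b > 0 as y > 0.
infixl 7 _/ᴿ_by_

_/ᴿ_by_ : ℕ → (y : ℝ) → Positive y → ℝ
n /ᴿ y by y>0 = record
  { lower     = λ r → ∃[ b ] ¬ lower y b × r ℚ.* b ℚ.< ι n
  ; inhabited = let b , b∉ = bounded y in
      ℚ.- 1ℚ , b , b∉ ,
      ℚ.<-≤-trans (*-monoˡ-< (below-bound y y>0 b∉) (ℚ.negative⁻¹ (ℚ.- 1ℚ)))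
                  (subst (ℚ._≤ ι n) (sym (ℚ.*-zeroˡ b)) (0≤ι n))
  ; bounded   = let a , a>0 , a∈ = rounded y y>0 in
      ι n ℚ.* inv a>0 , λ (b , b∉ , lt) → ℚ.<-irrefl refl (ℚ.<-≤-trans lt
        (subst (ℚ._≤ (ι n ℚ.* inv a>0) ℚ.* b) (*inv* a>0 (ι n))
          (ℚ.*-monoˡ-≤-nonNeg (ι n ℚ.* inv a>0)
            {{ℚ.nonNegative (nn a>0)}}
            (ℚ.<⇒≤ (below-bound y a∈ b∉)))))
  ; downwards = λ p<q (b , b∉ , lt) →
      b , b∉ , ℚ.<-trans (*-monoˡ-< (below-bound y y>0 b∉) p<q) lt
  ; rounded   = λ (b , b∉ , lt) →
      let b>0 = below-bound y y>0 b∉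
          t , pb<t , t<n = ℚ.<-dense lt
      in t ℚ.* inv b>0 , inv-> b>0 pb<t , b , b∉ ,
         subst (ℚ._< ι n) (sym (*inv* b>0 t)) t<n
  }
  where
  nn : ∀ {a} (a>0 : 0ℚ ℚ.< a) → 0ℚ ℚ.≤ ι n ℚ.* inv a>0
  nn {a} a>0 = ℚ.*-cancelʳ-≤-pos a {{ℚ.positive a>0}}
    (subst₂ ℚ._≤_ (sym (ℚ.*-zeroˡ a)) (sym (*inv* a>0 (ι n))) (0≤ι n))

2ℚ : ℚ
2ℚ = + 2 ℚ./ 1

2^ℤ : ℤ → ℚ
2^ℤ (+ k)    = 2ℚ ^ k
2^ℤ -[1+ k ] = ½ ^ suc k

-- For s = u / v and a > 0, 2 ^ s < a means 2 ^ u < a ^ v.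
2^_<_ : ℚ → ℚ → Set
2^ s < a = 2^ℤ (↥ s) ℚ.< a ^ ↧ₙ s

private
  ^-nonNeg : ∀ {a} → 0ℚ ℚ.≤ a → ∀ k → 0ℚ ℚ.≤ a ^ k
  ^-nonNeg h zero = ℚ.nonNegative⁻¹ 1ℚ
  ^-nonNeg {a} h (suc k) =
    subst (ℚ._≤ a ^ suc k) (ℚ.*-zeroˡ 0ℚ) (*-mono-≤ ℚ.≤-refl (^-nonNeg h k) h (^-nonNeg h k))

  ^-monoˡ-≤ : ∀ {a b} → 0ℚ ℚ.≤ a → a ℚ.≤ b → ∀ k → a ^ k ℚ.≤ b ^ k
  ^-monoˡ-≤ 0≤a a≤b zero = ℚ.≤-refl
  ^-monoˡ-≤ 0≤a a≤b (suc k) =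
    *-mono-≤ 0≤a (^-nonNeg (ℚ.≤-trans 0≤a a≤b) k) a≤b (^-monoˡ-≤ 0≤a a≤b k)

  0≤2 : 0ℚ ℚ.≤ 2ℚ
  0≤2 = ℚ.nonNegative⁻¹ 2ℚ

  1≤2 : 1ℚ ℚ.≤ 2ℚ
  1≤2 = decidable-stable (1ℚ ℚ.≤? 2ℚ) (λ ¬p → ¬p (ℚ.*≤* (ℤ.+≤+ (s≤s z≤n))))

  2^-step : ∀ k → 2ℚ ^ k ℚ.≤ 2ℚ ^ suc k
  2^-step k = subst (ℚ._≤ 2ℚ ^ suc k) (ℚ.*-identityˡ (2ℚ ^ k))
    (*-mono-≤ (ℚ.nonNegative⁻¹ 1ℚ) (^-nonNeg 0≤2 k) 1≤2 ℚ.≤-refl)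

  2^-mono-≤ : ∀ {j k} → j ℕ.≤′ k → 2ℚ ^ j ℚ.≤ 2ℚ ^ k
  2^-mono-≤ ℕ.≤′-refl = ℚ.≤-refl
  2^-mono-≤ (ℕ.≤′-step {k} j≤k) = ℚ.≤-trans (2^-mono-≤ j≤k) (2^-step k)

  ι-suc : ∀ k → ι (suc k) ≡ 1ℚ ℚ.+ ι k
  ι-suc k = trans
    (cong (λ z → z ℚ./ 1) {x = + 1 ℤ.+ + k} {y = + 1 ℤ.+ + k ℤ.* + 1}
      (cong (λ z → + 1 ℤ.+ z) (sym (ℤ.*-identityʳ (+ k)))))
    (cong (1ℚ ℚ.+_) (sym (ι≡ k)))

  1≤2^ : ∀ k → 1ℚ ℚ.≤ 2ℚ ^ k
  1≤2^ k = 2^-mono-≤ (ℕ.≤⇒≤′ (z≤n {k}))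

  ι≤2^ : ∀ k → ι k ℚ.≤ 2ℚ ^ k
  ι≤2^ zero = ℚ.nonNegative⁻¹ 1ℚ
  ι≤2^ (suc k) = subst₂ ℚ._≤_ (sym (ι-suc k)) eq (ℚ.+-mono-≤ (1≤2^ k) (ι≤2^ k))
    where
    eq : 2ℚ ^ k ℚ.+ 2ℚ ^ k ≡ 2ℚ ^ suc k
    eq = trans (sym (cong₂ ℚ._+_ (ℚ.*-identityˡ (2ℚ ^ k)) (ℚ.*-identityˡ (2ℚ ^ k))))
               (sym (ℚ.*-distribʳ-+ (2ℚ ^ k) 1ℚ 1ℚ))

  ≤ι : ∀ b → ∃ λ k → b ℚ.≤ ι k
  ≤ι (mkℚ (+ k) d c) = k , subst (mkℚ (+ k) d c ℚ.≤_) (sym (ι≡ k))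
    (ℚ.*≤* (ℤ.*-monoˡ-≤-nonNeg (+ k) (ℤ.+≤+ (s≤s (z≤n {d})))))
  ≤ι b@(mkℚ -[1+ _ ] _ _) = 0 , ℚ.nonPositive⁻¹ b

  ≤2^ : ∀ b → ∃ λ k → b ℚ.≤ 2ℚ ^ k
  ≤2^ b = let k , b≤k = ≤ι b in k , ℚ.≤-trans b≤k (ι≤2^ k)

  2*½ : ∀ k → (2ℚ ^ k) ℚ.* (½ ^ k) ≡ 1ℚ
  2*½ zero    = refl
  2*½ (suc k) = begin
    (2ℚ ℚ.* (2ℚ ^ k)) ℚ.* (½ ℚ.* (½ ^ k)) ≡⟨ ℚ.*-assoc 2ℚ (2ℚ ^ k) _ ⟩
    2ℚ ℚ.* ((2ℚ ^ k) ℚ.* (½ ℚ.* (½ ^ k))) ≡⟨ cong (2ℚ ℚ.*_) (ℚ.*-comm (2ℚ ^ k) _) ⟩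
    2ℚ ℚ.* ((½ ℚ.* (½ ^ k)) ℚ.* (2ℚ ^ k)) ≡⟨ cong (2ℚ ℚ.*_) (ℚ.*-assoc ½ (½ ^ k) (2ℚ ^ k)) ⟩
    2ℚ ℚ.* (½ ℚ.* ((½ ^ k) ℚ.* (2ℚ ^ k))) ≡⟨ cong (λ z → 2ℚ ℚ.* (½ ℚ.* z))
                                               (trans (ℚ.*-comm (½ ^ k) (2ℚ ^ k)) (2*½ k)) ⟩
    1ℚ                                    ∎
    where open ≡-Reasoning

  ½^< : ∀ {a} → 0ℚ ℚ.< a → ∃ λ k → ½ ^ suc k ℚ.< a
  ½^< {a} a>0 = k , subst₂ ℚ._<_ (ℚ.*-identityˡ (½ ^ suc k)) eq
                     (ℚ.*-monoˡ-<-pos (½ ^ suc k) {{ℚ.positive (½^>0 (suc k))}} step)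
    where
    k = proj₁ (≤2^ (inv a>0))
    ½^>0 : ∀ j → 0ℚ ℚ.< ½ ^ j
    ½^>0 zero    = ℚ.positive⁻¹ 1ℚ
    ½^>0 (suc j) = subst (ℚ._< ½ ^ suc j) (ℚ.*-zeroʳ ½)
                     (ℚ.*-monoʳ-<-pos ½ (½^>0 j))
    2^< : 2ℚ ^ k ℚ.< 2ℚ ^ suc k
    2^< = subst (ℚ._< 2ℚ ^ suc k) (ℚ.*-identityˡ (2ℚ ^ k))
            (ℚ.*-monoˡ-<-pos (2ℚ ^ k)
              {{ℚ.positive (ℚ.<-≤-trans (ℚ.positive⁻¹ 1ℚ) (1≤2^ k))}}
              {1ℚ} {2ℚ} (ℚ.*<* (ℤ.+<+ (s≤s (s≤s z≤n)))))
    step : 1ℚ ℚ.< (2ℚ ^ suc k) ℚ.* a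
    step = subst (ℚ._< (2ℚ ^ suc k) ℚ.* a) (ℚ.*-inverseˡ a {{b-nz a>0}})
             (*-monoˡ-< a>0 (ℚ.≤-<-trans (proj₂ (≤2^ (inv a>0))) 2^<))
    eq : ((2ℚ ^ suc k) ℚ.* a) ℚ.* (½ ^ suc k) ≡ a
    eq = begin
      ((2ℚ ^ suc k) ℚ.* a) ℚ.* (½ ^ suc k) ≡⟨ cong (ℚ._* (½ ^ suc k)) (ℚ.*-comm (2ℚ ^ suc k) a) ⟩
      (a ℚ.* (2ℚ ^ suc k)) ℚ.* (½ ^ suc k) ≡⟨ ℚ.*-assoc a _ _ ⟩
      a ℚ.* ((2ℚ ^ suc k) ℚ.* (½ ^ suc k)) ≡⟨ cong (a ℚ.*_) (2*½ (suc k)) ⟩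
      a ℚ.* 1ℚ                             ≡⟨ ℚ.*-identityʳ a ⟩
      a                                    ∎
      where open ≡-Reasoning

  2^≮ : ∀ {s a b k} → 0ℚ ℚ.< a → a ℚ.≤ b → b ℚ.≤ 2ℚ ^ k → ι k ℚ.< s → ¬ 2^ s < a
  2^≮ {mkℚ (+ p) d c} {a} {b} {k} a>0 a≤b b≤2^k k<s lt rewrite ι≡ k =
    ℚ.<-irrefl refl (ℚ.<-≤-trans lt (ℚ.≤-trans
      (^-monoˡ-≤ (ℚ.<⇒≤ a>0) (ℚ.≤-trans a≤b b≤2^k) (suc d))
      (subst (ℚ._≤ 2ℚ ^ p) (sym (Exp.^-assocʳ 2ℚ k (suc d)))
        (2^-mono-≤ (ℕ.≤⇒≤′ kd≤p)))))
    where
    kd≤p : k ℕ.* suc d ℕ.≤ p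
    kd≤p = ℤ.drop‿+≤+ (subst₂ ℤ._≤_ (sym (ℤ.pos-* k (suc d))) (ℤ.*-identityʳ (+ p))
             (ℤ.<⇒≤ (ℚ.drop-*<* k<s)))
  2^≮ {s@(mkℚ -[1+ _ ] _ _)} {k = k} _ _ _ k<s _ =
    ℚ.<-asym (ℚ.≤-<-trans (0≤ι k) k<s) (ℚ.negative⁻¹ s)

-- log₂ x = sup { s ∈ ℚ | 2 ^ s < x }.
log₂ : (x : ℝ) → Positive x → ℝ
log₂ x x>0 = record
  { lower     = λ r → ∃[ s ] ∃[ a ] r ℚ.< s × 0ℚ ℚ.< a × lower x a × 2^ s < a
  ; inhabited = let a , a>0 , a∈ = rounded x x>0
                    k , lt = ½^< a>0
                    s = mkℚ -[1+ k ] 0 (C.sym (C.1-coprimeTo (suc k)))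
                in s ℚ.- 1ℚ , s , a , -1-< s , a>0 , a∈ ,
                   subst (½ ^ suc k ℚ.<_) (sym (ℚ.*-identityʳ a)) lt
  ; bounded   = let b , b∉ = bounded x
                    k , b≤2^k = ≤2^ b
                in ι k , λ (s , a , k<s , a>0 , a∈ , lt) →
                     2^≮ {s} {k = k} a>0 (ℚ.<⇒≤ (below-bound x a∈ b∉)) b≤2^k k<s lt
  ; downwards = λ p<q (s , a , q<s , h) → s , a , ℚ.<-trans p<q q<s , h
  ; rounded   = λ (s , a , p<s , h) → let r , p<r , r<s = ℚ.<-dense p<s
                in r , p<r , s , a , r<s , h
  }

-- A relation, since the ceiling of a cut is not computable.
IsCeiling : ℝ → ℕ → Set
IsCeiling x k = fromℤ (+ k ℤ.- + 1) <ᴿ x × x ≤ᴿ fromℕ k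

Eventually : ∀ {ℓ} → (ℕ → Set ℓ) → Set ℓ
Eventually P = ∃[ N ] ∀ n → N ℕ.≤ n → P n

Growing : (ℕ → ℝ) → Set
Growing φ = ∀ (M : ℕ) → Eventually λ n → fromℕ M <ᴿ φ n

infix 4 _~_ _≲_

_~_ : (ℕ → ℕ) → (ℕ → ℕ) → Set
a ~ b = ∀ (ε : ℚ) → 0ℚ ℚ.< ε → Eventually λ n →
  Σ[ b≢0 ∈ ℕ.NonZero (b n) ] ℚ.∣ (ℚ._/_ (+ a n) (b n) {{b≢0}}) ℚ.- 1ℚ ∣ ℚ.< ε

-- lim sup a(n) / b(n) ≤ 1.
_≲_ : (ℕ → ℕ) → (ℕ → ℕ) → Set
a ≲ b = ∀ (ε : ℚ) → 0ℚ ℚ.< ε → Eventually λ n →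
  Σ[ b≢0 ∈ ℕ.NonZero (b n) ] (ℚ._/_ (+ a n) (b n) {{b≢0}}) ℚ.< 1ℚ ℚ.+ ε

𝔹^ : ℕ → Set
𝔹^ = Vec Bool

record Gate (m : ℕ) : Set where
  constructor TOF
  field
    controls   : Subset m
    target     : Fin m
    .target∉   : target ∉ controls
    .controls≤ : ∣ controls ∣ ℕ.≤ 2

-- x_{i₁} ∧ ⋯ ∧ x_{iₖ} over i ∈ I: coordinates outside I contribute true.
conj : ∀ {m} → Subset m → 𝔹^ m → Bool
conj I x = Vec.foldr′ _∧_ true (Vec.zipWith (λ i∈I xᵢ → not i∈I ∨ xᵢ) I x)

applyGate : ∀ {m} → Gate m → 𝔹^ m → 𝔹^ m
applyGate (TOF I t _ _) x = x Vec.[ t ]%= (_xor conj I x)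

Circuit : ℕ → Set
Circuit m = List (Gate m)

run : ∀ {m} → Circuit m → 𝔹^ m → 𝔹^ m
run []      x = x
run (g ∷ 𝔖) x = run 𝔖 (applyGate g x)

permute : ∀ {m} → Permutation′ m → 𝔹^ m → 𝔹^ m
permute π y = Vec.tabulate λ i → Vec.lookup y (π ⟨$⟩ʳ i)

-- The first n coordinates after permuting; the other q are garbage.
output : ∀ n q → Circuit (n ℕ.+ q) → Permutation′ (n ℕ.+ q) → 𝔹^ n → 𝔹^ n
output n q 𝔖 π x = Vec.take n (permute π (run 𝔖 (x Vec.++ Vec.replicate q false)))

Implements : ∀ n q → Circuit (n ℕ.+ q) → (𝔹^ n → 𝔹^ n) → Set
Implements n q 𝔖 f = ∃[ π ] ∀ x → output n q 𝔖 π x ≡ f x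

F : ∀ n q → (𝔹^ n → 𝔹^ n) → Set
F n q f = ∃[ 𝔖 ] Implements n q 𝔖 f

IsMinimum : (ℕ → Set) → ℕ → Set
IsMinimum P k = P k × (∀ j → P j → k ℕ.≤ j)

IsMaximum : (ℕ → Set) → ℕ → Set
IsMaximum P k = P k × (∀ j → P j → j ℕ.≤ k)

-- IsL[f,q] n q f k: L(f,q) = k.
IsL[f,q] : ∀ n q → (𝔹^ n → 𝔹^ n) → ℕ → Set
IsL[f,q] n q f = IsMinimum λ k → ∃[ 𝔖 ] Implements n q 𝔖 f × length 𝔖 ≡ k

-- IsL[n,q] n q k: L(n,q) = k.
IsL[n,q] : ℕ → ℕ → ℕ → Set
IsL[n,q] n q = IsMaximum λ k → ∃[ f ] F n q f × IsL[f,q] n q f k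

-- The maximum L(n,q) exists: its defining predicate is decidable by
-- exhaustive search, and a circuit longer than the number of maps
-- 𝔹ᵐ → 𝔹ᵐ repeats an intermediate map, so it can be shortened.
private
  anyGate? : ∀ {m} {P : Gate m → Set} → (∀ g → Dec (P g)) → Dec (∃ P)
  anyGate? {m} {P} P? = map′ to from
    (anySubset? λ I → Fin.any? λ t → dec I t)
    where
    Q : Subset m → Fin m → Set
    Q I t = Σ[ p ∈ t ∉ I ] Σ[ s ∈ ∣ I ∣ ℕ.≤ 2 ] P (TOF I t p s)
    dec : ∀ I t → Dec (Q I t)
    dec I t with ¬? (t ∈? I) | ∣ I ∣ ℕ.≤? 2
    ... | no ¬p | _     = no λ (p , _) → ¬p p
    ... | yes _ | no ¬s = no λ (_ , s , _) → ¬s s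
    ... | yes p | yes s = map′ (λ x → p , s , x) (λ (_ , _ , x) → x) (P? (TOF I t p s))
    to : (∃[ I ] ∃[ t ] Q I t) → ∃ P
    to (I , t , p , s , x) = TOF I t p s , x
    from : ∃ P → ∃[ I ] ∃[ t ] Q I t
    from (TOF I t p s , x) =
      I , t , recompute (¬? (t ∈? I)) p , recompute (∣ I ∣ ℕ.≤? 2) s , x

  anyCircuit? : ∀ {m} {P : Circuit m → Set} → (∀ 𝔖 → Dec (P 𝔖)) →
                ∀ k → Dec (∃[ 𝔖 ] length 𝔖 ≡ k × P 𝔖)
  anyCircuit? P? zero = map′ (λ p → [] , refl , p) (λ { ([] , _ , p) → p }) (P? [])
  anyCircuit? P? (suc k) = map′
    (λ (g , 𝔖 , e , p) → g ∷ 𝔖 , cong suc e , p)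
    (λ { (g ∷ 𝔖 , e , p) → g , 𝔖 , ℕ.suc-injective e , p })
    (anyGate? λ g → anyCircuit? (λ 𝔖 → P? (g ∷ 𝔖)) k)

  anyVec? : ∀ {k} n {P : Vec (Fin k) n → Set} → (∀ v → Dec (P v)) → Dec (∃ P)
  anyVec? zero    P? = map′ (λ p → [] , p) (λ { ([] , p) → p }) (P? [])
  anyVec? (suc n) P? = map′ (λ (i , v , p) → i ∷ v , p) (λ { (i ∷ v , p) → i , v , p })
    (Fin.any? λ i → anyVec? n λ v → P? (i ∷ v))

  all𝔹? : ∀ {n} {P : 𝔹^ n → Set} → (∀ x → Dec (P x)) → Dec (∀ x → P x)
  all𝔹? P? = map′ (λ ¬∃ x → decidable-stable (P? x) λ ¬p → ¬∃ (x , ¬p))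
                  (λ ∀p (x , ¬p) → ¬p (∀p x))
                  (¬? (anySubset? λ x → ¬? (P? x)))

  anyPerm? : ∀ {m} {P : Permutation′ m → Set} →
             (∀ {π ρ} → (∀ i → π ⟨$⟩ʳ i ≡ ρ ⟨$⟩ʳ i) → P π → P ρ) →
             (∀ π → Dec (P π)) → Dec (∃ P)
  anyPerm? {m} {P} resp P? = map′ to from (anyVec? m λ v → anyVec? m λ w → dec v w)
    where
    Inv : Vec (Fin m) m → Vec (Fin m) m → Set
    Inv v w = ∀ i → Vec.lookup v (Vec.lookup w i) ≡ i
    perm : ∀ v w → Inv v w → Inv w v → Permutation′ m
    perm v w = permutation (Vec.lookup v) (Vec.lookup w)
    Q : Vec (Fin m) m → Vec (Fin m) m → Set
    Q v w = Σ[ p ∈ Inv v w ] Σ[ p′ ∈ Inv w v ] P (perm v w p p′)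
    dec : ∀ v w → Dec (Q v w)
    dec v w with Fin.all? (λ i → Vec.lookup v (Vec.lookup w i) Fin.≟ i)
               | Fin.all? (λ i → Vec.lookup w (Vec.lookup v i) Fin.≟ i)
    ... | no ¬p | _      = no λ (p , _) → ¬p p
    ... | yes _ | no ¬p′ = no λ (_ , p′ , _) → ¬p′ p′
    ... | yes p | yes p′ = map′ (λ x → p , p′ , x)
            (λ (_ , _ , x) → resp (λ _ → refl) x) (P? (perm v w p p′))
    to : (∃[ v ] ∃[ w ] Q v w) → ∃ P
    to (v , w , p , p′ , x) = perm v w p p′ , x
    from : ∃ P → ∃[ v ] ∃[ w ] Q v w
    from (π , x) = v , w , vw , wv , resp (λ i → sym (Vec.lookup∘tabulate (π ⟨$⟩ʳ_) i)) x
      where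
      v = Vec.tabulate (π ⟨$⟩ʳ_)
      w = Vec.tabulate (π ⟨$⟩ˡ_)
      vw : Inv v w
      vw i = trans (Vec.lookup∘tabulate (π ⟨$⟩ʳ_) _)
        (trans (cong (π ⟨$⟩ʳ_) (Vec.lookup∘tabulate (π ⟨$⟩ˡ_) i)) (inverseʳ π))
      wv : Inv w v
      wv i = trans (Vec.lookup∘tabulate (π ⟨$⟩ˡ_) _)
        (trans (cong (π ⟨$⟩ˡ_) (Vec.lookup∘tabulate (π ⟨$⟩ʳ_) i)) (inverseˡ π))

  output-cong : ∀ n q 𝔖 {π ρ} → (∀ i → π ⟨$⟩ʳ i ≡ ρ ⟨$⟩ʳ i) →
                ∀ x → output n q 𝔖 π x ≡ output n q 𝔖 ρ x
  output-cong n q 𝔖 eq x = cong (Vec.take n)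
    (Vec.tabulate-cong λ i → cong (Vec.lookup (run 𝔖 _)) (eq i))

  implements? : ∀ n q 𝔖 f → Dec (Implements n q 𝔖 f)
  implements? n q 𝔖 f = anyPerm?
    (λ {π} {ρ} eq h x → trans (sym (output-cong n q 𝔖 {π} {ρ} eq x)) (h x))
    (λ π → all𝔹? λ x → Vec.≡-dec Bool._≟_ (output n q 𝔖 π x) (f x))

  implements-cong : ∀ n q 𝔖 {f g} → (∀ x → f x ≡ g x) →
                    Implements n q 𝔖 f → Implements n q 𝔖 g
  implements-cong n q 𝔖 eq (π , h) = π , λ x → trans (h x) (eq x)

  Shorter : ∀ n q → (𝔹^ n → 𝔹^ n) → ℕ → Set
  Shorter n q f k = ∃[ j ] j ℕ.< k × ∃[ 𝔖 ] length 𝔖 ≡ j × Implements n q 𝔖 f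

  shorter-cong : ∀ n q k {f g} → (∀ x → f x ≡ g x) → Shorter n q f k → Shorter n q g k
  shorter-cong n q k eq (j , j<k , 𝔖 , e , h) = j , j<k , 𝔖 , e , implements-cong n q 𝔖 eq h

  shorter? : ∀ n q f k → Dec (Shorter n q f k)
  shorter? n q f k = ℕ.anyUpTo? (anyCircuit? λ 𝔖 → implements? n q 𝔖 f) k

  Value : ∀ n q → ℕ → Set
  Value n q k = ∃[ f ] F n q f × IsL[f,q] n q f k

  value? : ∀ n q k → Dec (Value n q k)
  value? n q k = map′ to from (anyCircuit? (λ 𝔖 → anyPerm?
      (λ {π} {ρ} eq ¬s s → ¬s (shorter-cong n q k
        (λ x → sym (output-cong n q 𝔖 {π} {ρ} eq x)) s))
      (λ π → ¬? (shorter? n q (output n q 𝔖 π) k))) k)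
    where
    E : Set
    E = ∃[ 𝔖 ] length 𝔖 ≡ k × ∃[ π ] ¬ Shorter n q (output n q 𝔖 π) k
    to : E → Value n q k
    to (𝔖 , e , π , ¬s) = output n q 𝔖 π , (𝔖 , imp) , (𝔖 , imp , e) ,
      λ j (𝔖′ , h , e′) → ℕ.≮⇒≥ λ j<k → ¬s (j , j<k , 𝔖′ , e′ , h)
      where imp = π , λ _ → refl
    from : Value n q k → E
    from (f , _ , (𝔖 , (π , h) , e) , min) = 𝔖 , e , π ,
      λ (j , j<k , 𝔖′ , e′ , h′) → ℕ.<⇒≱ j<k (min j (𝔖′ , implements-cong n q 𝔖′ h h′ , e′))

  bit : Bool → Fin 2
  bit false = zero
  bit true  = suc zero

  unbit : Fin 2 → Bool
  unbit zero    = false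
  unbit (suc _) = true

  unbit-bit : ∀ b → unbit (bit b) ≡ b
  unbit-bit false = refl
  unbit-bit true  = refl

  enc : ∀ {m} → 𝔹^ m → Fin (2 ℕ.^ m)
  enc x = funToFin (bit ∘ Vec.lookup x)

  dec : ∀ {m} → Fin (2 ℕ.^ m) → 𝔹^ m
  dec k = Vec.tabulate (unbit ∘ finToFun k)

  dec-enc : ∀ {m} (x : 𝔹^ m) → dec (enc x) ≡ x
  dec-enc x = trans
    (Vec.tabulate-cong λ i → trans
      (cong unbit (Fin.finToFun-funToFin (bit ∘ Vec.lookup x) i))
      (unbit-bit (Vec.lookup x i)))
    (Vec.tabulate∘lookup x)

  maps : ℕ → ℕ
  maps m = (2 ℕ.^ m) ℕ.^ (2 ℕ.^ m)

  code : ∀ {m} → (𝔹^ m → 𝔹^ m) → Fin (maps m)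
  code g = funToFin (enc ∘ g ∘ dec)

  code-injective : ∀ {m} (g h : 𝔹^ m → 𝔹^ m) → code g ≡ code h → ∀ x → g x ≡ h x
  code-injective g h eq x = subst (λ y → g y ≡ h y) (dec-enc x) (begin
    g (dec i)             ≡⟨ dec-enc _ ⟨
    dec (enc (g (dec i))) ≡⟨ cong dec (Fin.finToFun-funToFin (enc ∘ g ∘ dec) i) ⟨
    dec (finToFun (code g) i) ≡⟨ cong (λ c → dec (finToFun c i)) eq ⟩
    dec (finToFun (code h) i) ≡⟨ cong dec (Fin.finToFun-funToFin (enc ∘ h ∘ dec) i) ⟩
    dec (enc (h (dec i))) ≡⟨ dec-enc _ ⟩
    h (dec i)             ∎)
    where open ≡-Reasoning
          i = enc x

  run-++ : ∀ {m} (𝔖 𝔗 : Circuit m) x → run (𝔖 ++ 𝔗) x ≡ run 𝔗 (run 𝔖 x)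
  run-++ []      𝔗 x = refl
  run-++ (g ∷ 𝔖) 𝔗 x = run-++ 𝔖 𝔗 (applyGate g x)

  shorten : ∀ {m} (𝔖 : Circuit m) → maps m ℕ.≤ length 𝔖 →
            ∃[ 𝔗 ] length 𝔗 ℕ.< length 𝔖 × (∀ x → run 𝔗 x ≡ run 𝔖 x)
  shorten {m} 𝔖 long = 𝔗 , len , same
    where
    prefix : Fin (suc (length 𝔖)) → Circuit m
    prefix i = List.take (toℕ i) 𝔖
    ph = Fin.pigeonhole (s≤s long) (λ i → code (run (prefix i)))
    i = proj₁ ph
    j = proj₁ (proj₂ ph)
    i<j = proj₁ (proj₂ (proj₂ ph))
    eq = code-injective _ _ (proj₂ (proj₂ (proj₂ ph)))
    rest = List.drop (toℕ j) 𝔖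
    𝔗 = prefix i ++ rest
    whole : prefix j ++ rest ≡ 𝔖
    whole = List.take++drop≡id (toℕ j) 𝔖
    j≤ : toℕ j ℕ.≤ length 𝔖
    j≤ = ℕ.≤-pred (Fin.toℕ<n j)
    len : length 𝔗 ℕ.< length 𝔖
    len = subst₂ ℕ._<_ (sym (List.length-++ (prefix i)))
      (trans (sym (List.length-++ (prefix j))) (cong length whole))
      (ℕ.+-monoˡ-< (length rest)
        (subst₂ ℕ._<_ (sym (trans (List.length-take (toℕ i) 𝔖) (ℕ.m≤n⇒m⊓n≡m (ℕ.≤-trans (ℕ.<⇒≤ i<j) j≤))))
                      (sym (trans (List.length-take (toℕ j) 𝔖) (ℕ.m≤n⇒m⊓n≡m j≤))) i<j))
    same : ∀ x → run 𝔗 x ≡ run 𝔖 x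
    same x = begin
      run (prefix i ++ rest) x     ≡⟨ run-++ (prefix i) rest x ⟩
      run rest (run (prefix i) x)  ≡⟨ cong (run rest) (eq x) ⟩
      run rest (run (prefix j) x)  ≡⟨ run-++ (prefix j) rest x ⟨
      run (prefix j ++ rest) x     ≡⟨ cong (λ c → run c x) whole ⟩
      run 𝔖 x                      ∎
      where open ≡-Reasoning

  value-bound : ∀ n q k → Value n q k → k ℕ.≤ maps (n ℕ.+ q)
  value-bound n q k (f , _ , (𝔖 , (π , h) , refl) , min) = ℕ.≮⇒≥ λ k>B →
    let 𝔗 , lt , same = shorten 𝔖 (ℕ.<⇒≤ k>B) in
    ℕ.<⇒≱ lt (min _ (𝔗 , (π , λ x → trans (cong (λ y → Vec.take n (permute π y)) (same _)) (h x)) , refl))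

  maximum : ∀ {P : ℕ → Set} → (∀ k → Dec (P k)) → P 0 →
            ∀ B → (∀ k → P k → k ℕ.≤ B) → ∃ (IsMaximum P)
  maximum P? p₀ zero    bd = 0 , p₀ , bd
  maximum P? p₀ (suc B) bd with P? (suc B)
  ... | yes p = suc B , p , bd
  ... | no ¬p = maximum P? p₀ B λ k pk →
          ℕ.≤-pred (ℕ.≤∧≢⇒< (bd k pk) λ { refl → ¬p pk })

abstract
  L-exists : ∀ n q → ∃ (IsL[n,q] n q)
  L-exists n q = maximum (value? n q)
    (output n q [] Perm.id , ([] , Perm.id , λ _ → refl) ,
      ([] , (Perm.id , λ _ → refl) , refl) , λ _ _ → z≤n)
    (maps (n ℕ.+ q)) (value-bound n q)

L : ℕ → ℕ → ℕ
L n q = proj₁ (L-exists n q)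

L-spec : ∀ n q → IsL[n,q] n q (L n q)
L-spec n q = proj₂ (L-exists n q)

{-# OPTIONS --safe #-}

-- Write t = n − ⌈n/φ⌉ and split the n variables into k and l = n − k, with M n ≤ 2ᵏ ≤ 2 M n for a
-- large constant M = 2ᵃ.  Cut the 2ᵏ assignments of the first k variables into p ≈ 2ᵏ / t groups of
-- size at most t.  For one group, 2ᵗ ancillas can hold all functions of the first k variables that
-- are supported on the group; given this table, each assignment of the last l variables costs one
-- Toffoli gate per component of f, since the corresponding restriction of f to the group is a table
-- entry.  This takes p · 2ˡ · n ≈ (n / t) · 2ⁿ ~ 2ⁿ gates.  The table is cleared and reused for the
-- next group; filling it costs about 2ᵏ · 2ᵗ gates, which is negligible because the bound on φ makes
-- 2 ^ ⌈n/φ⌉ larger than any constant multiple of n.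
module Submission where

open import Defs
open import Data.Bool.Base using (Bool; true; false; if_then_else_; not; _∧_; _xor_)
open import Data.Bool.Properties
  using (∧-identityʳ; ∧-idem; ∧-distribʳ-xor; xor-identityʳ; xor-same; xor-assoc; xor-comm; T-≡)
open import Data.Fin.Base using (Fin; zero; suc; toℕ; _↑ˡ_; _↑ʳ_; splitAt; funToFin; finToFun)
open import Data.Fin.Properties
  using (_≟_; suc-injective; ↑ˡ-injective; ↑ʳ-injective; splitAt-↑ˡ; splitAt-↑ʳ; finToFun-funToFin;
         toℕ<n; toℕ-injective; toℕ-fromℕ<)
import Data.Fin.Permutation as Perm
open import Data.Fin.Subset using (Subset; ∣_∣; _∉_; _∪_; ⁅_⁆; ⊥)
open import Data.Fin.Subset.Properties using (x∈p∪q⁻; x∈⁅y⁆⇒x≡y; ∣⊥∣≡0; ∣⁅x⁆∣≡1; ∉⊥)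
open import Data.Integer.Base as ℤ using (-[1+_])
import Data.Integer.Properties as ℤ
open import Data.List.Base using (List; []; _∷_; _++_; length; concatMap; tabulate)
open import Data.List.Properties using (length-++; length-tabulate)
open import Data.List.Relation.Unary.All as All using (All; []; _∷_)
import Data.List.Relation.Unary.All.Properties as All
open import Data.Nat.Base
  using (ℕ; zero; suc; _+_; _*_; _∸_; _^_; _≤_; _<_; _⊔_; z≤n; s≤s; _≡ᵇ_; _<ᵇ_;
         NonZero; >-nonZero; >-nonZero⁻¹)
import Data.Nat.Coprimality as Coprimality
open import Data.Nat.DivMod
  using (_/_; _%_; _mod_; m%n<n; m<n⇒m%n≡m; m≡m%n+[m/n]*n; m/n*n≤m; m<n*o⇒m/o<n)
open import Data.Nat.Properties as ℕ
  using (≤-refl; ≤-trans; ≤-reflexive; +-mono-≤; *-mono-≤; *-monoʳ-≤; *-monoˡ-≤; n≤1+n)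
open import Data.Nat.Tactic.RingSolver using (solve-∀)
open import Data.Product.Base using (_×_; _,_; proj₁; proj₂; ∃-syntax; Σ-syntax)
open import Data.Rational as ℚ using (ℚ; mkℚ; 0ℚ; 1ℚ; ½)
import Data.Rational.Properties as ℚ
import Data.Rational.Unnormalised as ℚᵘ
import Data.Rational.Unnormalised.Properties as ℚᵘ
open import Data.Sum.Base using ([_,_]′; inj₁; inj₂)
open import Data.Vec.Base as Vec using ([]; _∷_; lookup; _[_]%=_; _[_]≔_)
import Data.Vec.Properties as Vec
open import Function.Base using (_∘_; const)
open import Function.Bundles using (Equivalence)
open import Relation.Binary.PropositionalEquality
open import Relation.Nullary using (¬_; yes; no; contradiction)
open import Algebra.Definitions.RawSemiring ℚ.+-*-rawSemiring using () renaming (_^_ to _^ℚ_)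

-- Circuits

-- The lookup may cost only n + O(1) gates for each of the 2ˡ assignments, so none of them can
-- afford to decode its own l address bits. `multiplex` therefore walks the binary tree of addresses
-- and keeps the current path in scratch lines, at four extra gates per branching. Gates cannot be
-- chosen by the input, so every stage runs on every input: a stage for the wrong group loads only
-- zeros and adds nothing to the results, which accumulate by xor. Loading xors a function of
-- unchanged input lines into the table, hence repeating it clears the table. The asymptotic claim
-- becomes one about integers: with E ε > 1 the goal is E · L ≤ (E + 1) 2ⁿ, and M = 2 ^ (5 E). The
-- lower bound on 2ᵏ makes the rounding of p negligible; the upper bound keeps p below a constant,
-- so that loading stays cheap.

∣p∪q∣≤∣p∣+∣q∣ : ∀ {m} (p q : Subset m) → ∣ p ∪ q ∣ ≤ ∣ p ∣ + ∣ q ∣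
∣p∪q∣≤∣p∣+∣q∣ []          []          = z≤n
∣p∪q∣≤∣p∣+∣q∣ (true  ∷ p) (true  ∷ q) =
  s≤s (≤-trans (∣p∪q∣≤∣p∣+∣q∣ p q) (ℕ.+-monoʳ-≤ ∣ p ∣ (n≤1+n ∣ q ∣)))
∣p∪q∣≤∣p∣+∣q∣ (true  ∷ p) (false ∷ q) = s≤s (∣p∪q∣≤∣p∣+∣q∣ p q)
∣p∪q∣≤∣p∣+∣q∣ (false ∷ p) (true  ∷ q) =
  ≤-trans (s≤s (∣p∪q∣≤∣p∣+∣q∣ p q)) (≤-reflexive (sym (ℕ.+-suc ∣ p ∣ ∣ q ∣)))
∣p∪q∣≤∣p∣+∣q∣ (false ∷ p) (false ∷ q) = ∣p∪q∣≤∣p∣+∣q∣ p q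

conj-⊥ : ∀ {m} (z : 𝔹^ m) → conj ⊥ z ≡ true
conj-⊥ []      = refl
conj-⊥ (_ ∷ z) = conj-⊥ z

conj-⁅⁆ : ∀ {m} (i : Fin m) z → conj ⁅ i ⁆ z ≡ lookup z i
conj-⁅⁆ zero    (b ∷ z) = trans (cong (b ∧_) (conj-⊥ z)) (∧-identityʳ b)
conj-⁅⁆ (suc i) (_ ∷ z) = conj-⁅⁆ i z

conj-∪ : ∀ {m} (I J : Subset m) z → conj (I ∪ J) z ≡ conj I z ∧ conj J z
conj-∪ []          []          []          = refl
conj-∪ (false ∷ I) (false ∷ J) (_ ∷ z)     = conj-∪ I J z
conj-∪ (true  ∷ I) (false ∷ J) (false ∷ z) = refl
conj-∪ (true  ∷ I) (false ∷ J) (true  ∷ z) = conj-∪ I J z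
conj-∪ (true  ∷ I) (true  ∷ J) (false ∷ z) = refl
conj-∪ (true  ∷ I) (true  ∷ J) (true  ∷ z) = conj-∪ I J z
conj-∪ (false ∷ I) (true  ∷ J) (true  ∷ z) = conj-∪ I J z
conj-∪ (false ∷ I) (true  ∷ J) (false ∷ z) with conj I z
... | true  = refl
... | false = refl

run-++ : ∀ {m} (𝔖 𝔗 : Circuit m) z → run (𝔖 ++ 𝔗) z ≡ run 𝔗 (run 𝔖 z)
run-++ []      𝔗 z = refl
run-++ (g ∷ 𝔖) 𝔗 z = run-++ 𝔖 𝔗 (applyGate g z)

xor-at : ∀ {m} → Fin m → Bool → 𝔹^ m → 𝔹^ m
xor-at t b z = z [ t ]%= (_xor b)

xor-at-self : ∀ {m} t b (z : 𝔹^ m) → lookup (xor-at t b z) t ≡ lookup z t xor b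
xor-at-self t b z = Vec.lookup∘updateAt t z

xor-at-other : ∀ {m} {t j} b (z : 𝔹^ m) → j ≢ t → lookup (xor-at t b z) j ≡ lookup z j
xor-at-other b z j≢t = Vec.lookup∘updateAt′ _ _ j≢t z

xor-at-false : ∀ {m} t (z : 𝔹^ m) → xor-at t false z ≡ z
xor-at-false t z = Vec.updateAt-id-local t z (xor-identityʳ _)

xor-at-≔ : ∀ {m} {t j} b v (z : 𝔹^ m) → t ≢ j → xor-at t b (z [ j ]≔ v) ≡ xor-at t b z [ j ]≔ v
xor-at-≔ b v z t≢j = Vec.updateAt-commutes _ _ t≢j z

module _ {m : ℕ} where

  Line : Set
  Line = Fin m

  NOT : Line → Circuit m
  NOT t = TOF ⊥ t ∉⊥ (≤-trans (≤-reflexive (∣⊥∣≡0 m)) z≤n) ∷ []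

  run-NOT : ∀ t z → run (NOT t) z ≡ xor-at t true z
  run-NOT t z = cong (λ b → xor-at t b z) (conj-⊥ z)

  private
    controls : Line → Line → Subset m
    controls c₁ c₂ = ⁅ c₁ ⁆ ∪ ⁅ c₂ ⁆

    t∉controls : ∀ {c₁ c₂ t} → c₁ ≢ t → c₂ ≢ t → t ∉ controls c₁ c₂
    t∉controls {c₁} {c₂} c₁≢t c₂≢t t∈ =
      [ (λ t∈₁ → c₁≢t (sym (x∈⁅y⁆⇒x≡y c₁ t∈₁)))
      , (λ t∈₂ → c₂≢t (sym (x∈⁅y⁆⇒x≡y c₂ t∈₂))) ]′ (x∈p∪q⁻ ⁅ c₁ ⁆ ⁅ c₂ ⁆ t∈)

    ∣controls∣≤2 : ∀ c₁ c₂ → ∣ controls c₁ c₂ ∣ ≤ 2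
    ∣controls∣≤2 c₁ c₂ = ≤-trans (∣p∪q∣≤∣p∣+∣q∣ ⁅ c₁ ⁆ ⁅ c₂ ⁆)
      (≤-reflexive (cong₂ _+_ (∣⁅x⁆∣≡1 c₁) (∣⁅x⁆∣≡1 c₂)))

  -- A CNOT when c₁ = c₂, and the empty circuit when the target is a control.
  toffoli : Line → Line → Line → Circuit m
  toffoli c₁ c₂ t with c₁ ≟ t | c₂ ≟ t
  ... | no c₁≢t | no c₂≢t =
    TOF (controls c₁ c₂) t (t∉controls c₁≢t c₂≢t) (∣controls∣≤2 c₁ c₂) ∷ []
  ... | _       | _       = []

  length-toffoli : ∀ c₁ c₂ t → length (toffoli c₁ c₂ t) ≤ 1
  length-toffoli c₁ c₂ t with c₁ ≟ t | c₂ ≟ t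
  ... | no _  | no _  = ≤-refl
  ... | no _  | yes _ = z≤n
  ... | yes _ | _     = z≤n

  run-toffoli : ∀ {c₁ c₂ t} z → c₁ ≢ t → c₂ ≢ t →
                run (toffoli c₁ c₂ t) z ≡ xor-at t (lookup z c₁ ∧ lookup z c₂) z
  run-toffoli {c₁} {c₂} {t} z c₁≢t c₂≢t with c₁ ≟ t | c₂ ≟ t
  ... | no _     | no _     = cong (λ b → xor-at t b z)
    (trans (conj-∪ ⁅ c₁ ⁆ ⁅ c₂ ⁆ z) (cong₂ _∧_ (conj-⁅⁆ c₁ z) (conj-⁅⁆ c₂ z)))
  ... | no _     | yes c₂≡t = contradiction c₂≡t c₂≢t
  ... | yes c₁≡t | _        = contradiction c₁≡t c₁≢t

  -- A list of CNOTs, given by control and target.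
  Wiring : Set
  Wiring = List (Line × Line)

  cnots : Wiring → 𝔹^ m → 𝔹^ m
  cnots []            z = z
  cnots ((c , d) ∷ B) z = cnots B (xor-at d (lookup z c) z)

  -- A wiring that neither reads nor writes line j ignores its value. This lets the multiplexer keep
  -- path information in scratch lines while a leaf is executed.
  cnots-≔ : ∀ {j} B v z → All (λ (c , d) → c ≢ j × d ≢ j) B →
            cnots B (z [ j ]≔ v) ≡ cnots B z [ j ]≔ v
  cnots-≔ []            v z []                    = refl
  cnots-≔ {j} ((c , d) ∷ B) v z ((c≢j , d≢j) ∷ ps) = begin
    cnots B (xor-at d (lookup (z [ j ]≔ v) c) (z [ j ]≔ v))
      ≡⟨ cong (λ b → cnots B (xor-at d b (z [ j ]≔ v))) (Vec.lookup∘update′ c≢j z v) ⟩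
    cnots B (xor-at d (lookup z c) (z [ j ]≔ v))
      ≡⟨ cong (cnots B) (xor-at-≔ (lookup z c) v z d≢j) ⟩
    cnots B (xor-at d (lookup z c) z [ j ]≔ v)
      ≡⟨ cnots-≔ B v _ ps ⟩
    cnots B (xor-at d (lookup z c) z) [ j ]≔ v ∎
    where open ≡-Reasoning

  cnots-other : ∀ {j} B z → All (λ (_ , d) → d ≢ j) B → lookup (cnots B z) j ≡ lookup z j
  cnots-other []            z []         = refl
  cnots-other ((c , d) ∷ B) z (d≢j ∷ ps) =
    trans (cnots-other B _ ps) (xor-at-other (lookup z c) z (d≢j ∘ sym))

  controlled : Line → Wiring → Circuit m
  controlled r = concatMap λ (c , d) → toffoli r c d

  length-controlled : ∀ r B → length (controlled r B) ≤ length B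
  length-controlled r []            = z≤n
  length-controlled r ((c , d) ∷ B) =
    ≤-trans (≤-reflexive (length-++ (toffoli r c d)))
      (+-mono-≤ (length-toffoli r c d) (length-controlled r B))

  -- No CNOT of the list targets r, so the control bit is the same for all of them and they fire
  -- together or not at all.
  run-controlled : ∀ {r} B z → All (λ (c , d) → c ≢ d × d ≢ r) B →
                   run (controlled r B) z ≡ (if lookup z r then cnots B z else z)
  run-controlled {r} [] z [] with lookup z r
  ... | true  = refl
  ... | false = refl
  run-controlled {r} ((c , d) ∷ B) z ((c≢d , d≢r) ∷ ps) = begin
    run (toffoli r c d ++ controlled r B) z
      ≡⟨ run-++ (toffoli r c d) _ z ⟩
    run (controlled r B) (run (toffoli r c d) z)
      ≡⟨ cong (run (controlled r B)) (run-toffoli z (d≢r ∘ sym) c≢d) ⟩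
    run (controlled r B) z′
      ≡⟨ run-controlled B z′ ps ⟩
    (if lookup z′ r then cnots B z′ else z′)
      ≡⟨ cong (if_then cnots B z′ else z′) (xor-at-other _ z (d≢r ∘ sym)) ⟩
    (if lookup z r then cnots B z′ else z′)
      ≡⟨ step (lookup z r) ⟩
    (if lookup z r then cnots B (xor-at d (lookup z c) z) else z) ∎
    where
    open ≡-Reasoning
    z′ = xor-at d (lookup z r ∧ lookup z c) z
    step : ∀ b → let z″ = xor-at d (b ∧ lookup z c) z in
           (if b then cnots B z″ else z″) ≡ (if b then cnots B (xor-at d (lookup z c) z) else z)
    step true  = refl
    step false = xor-at-false d z

  -- A depth-first walk over the addresses. The scratch line `as zero` becomes r ∧ x and is the root
  -- of the true half; xoring r turns it into r ∧ ¬ x, the root of the false half; xoring r ∧ x and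
  -- r once more returns it to 0.
  multiplex : ∀ {l} → Line → (xs as : Fin l → Line) → (𝔹^ l → Wiring) → Circuit m
  multiplex {zero}  r xs as B = controlled r (B [])
  multiplex {suc l} r xs as B =
    toffoli r (xs zero) (as zero) ++
    multiplex (as zero) (xs ∘ suc) (as ∘ suc) (B ∘ (true ∷_)) ++
    toffoli r r (as zero) ++
    multiplex (as zero) (xs ∘ suc) (as ∘ suc) (B ∘ (false ∷_)) ++
    toffoli r (xs zero) (as zero) ++
    toffoli r r (as zero)

  -- There are 2ˡ leaves of at most N gates and 2ˡ - 1 branchings of at most four gates. The summand
  -- 4 on the left makes up for the missing branching, so that the two halves add up exactly in the
  -- induction.
  length-multiplex : ∀ {l} r (xs as : Fin l → Line) B N → (∀ σ → length (B σ) ≤ N) →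
                     length (multiplex r xs as B) + 4 ≤ 2 ^ l * (4 + N)
  length-multiplex {zero} r xs as B N h = begin
    length (controlled r (B [])) + 4 ≤⟨ ℕ.+-monoˡ-≤ 4 (≤-trans (length-controlled r (B [])) (h [])) ⟩
    N + 4                            ≡⟨ ℕ.+-comm N 4 ⟩
    4 + N                            ≡⟨ ℕ.*-identityˡ (4 + N) ⟨
    1 * (4 + N)                      ∎
    where open ℕ.≤-Reasoning
  length-multiplex {suc l} r xs as B N h = begin
    length (T ++ M true ++ T′ ++ M false ++ T ++ T′) + 4 ≡⟨ cong (_+ 4) lengths ⟩
    (length T + (length (M true) + (length T′ + (length (M false) + (length T + length T′))))) + 4
      ≤⟨ ℕ.+-monoˡ-≤ 4 (+-mono-≤ lT (ℕ.+-monoʳ-≤ (length (M true))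
           (+-mono-≤ lT′ (ℕ.+-monoʳ-≤ (length (M false)) (+-mono-≤ lT lT′))))) ⟩
    (1 + (length (M true) + (1 + (length (M false) + (1 + 1))))) + 4
      ≡⟨ rearrange (length (M true)) (length (M false)) ⟩
    (length (M true) + 4) + (length (M false) + 4) ≤⟨ +-mono-≤ (ih true) (ih false) ⟩
    2 ^ l * (4 + N) + 2 ^ l * (4 + N) ≡⟨ double (2 ^ l) N ⟩
    2 ^ suc l * (4 + N) ∎
    where
    open ℕ.≤-Reasoning
    T  = toffoli r (xs zero) (as zero)
    T′ = toffoli r r (as zero)
    lT  = length-toffoli r (xs zero) (as zero)
    lT′ = length-toffoli r r (as zero)
    M : Bool → Circuit m
    M b = multiplex (as zero) (xs ∘ suc) (as ∘ suc) (B ∘ (b ∷_))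
    ih : ∀ b → length (M b) + 4 ≤ 2 ^ l * (4 + N)
    ih b = length-multiplex (as zero) (xs ∘ suc) (as ∘ suc) (B ∘ (b ∷_)) N (h ∘ (b ∷_))
    lengths : length (T ++ M true ++ T′ ++ M false ++ T ++ T′) ≡
              length T + (length (M true) + (length T′ + (length (M false) + (length T + length T′))))
    lengths = trans (length-++ T) (cong (length T +_) (trans (length-++ (M true))
      (cong (length (M true) +_) (trans (length-++ T′) (cong (length T′ +_)
      (trans (length-++ (M false)) (cong (length (M false) +_) (length-++ T))))))))
    rearrange : ∀ a b → (1 + (a + (1 + (b + (1 + 1))))) + 4 ≡ (a + 4) + (b + 4)
    rearrange = solve-∀
    double : ∀ a N → a * (4 + N) + a * (4 + N) ≡ (2 * a) * (4 + N)
    double = solve-∀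

  address : ∀ {l} → (Fin l → Line) → 𝔹^ m → 𝔹^ l
  address xs z = Vec.tabulate (lookup z ∘ xs)

  -- A leaf must leave root, address and scratch lines intact, and must not read scratch lines,
  -- whose values depend on the path. Reading the root or the address is allowed: `load-wiring`
  -- takes the root `one` as a source.
  Compatible : ∀ {l} → Line → (xs as : Fin l → Line) → Line × Line → Set
  Compatible r xs as (c , d) =
    c ≢ d × d ≢ r × (∀ i → d ≢ xs i) × (∀ i → c ≢ as i) × (∀ i → d ≢ as i)

  record Disjoint {l} (r : Line) (xs as : Fin l → Line) : Set where
    field
      as-injective : ∀ {i j} → as i ≡ as j → i ≡ j
      xs≢as        : ∀ i j → xs i ≢ as j
      r≢as         : ∀ j → r ≢ as j

  open Disjoint

  -- With the scratch lines cleared, exactly the leaf selected by the address has an active root.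
  run-multiplex : ∀ {l} {r} {xs as : Fin l → Line} B → Disjoint r xs as →
    (∀ σ → All (Compatible r xs as) (B σ)) →
    ∀ z → (∀ i → lookup z (as i) ≡ false) →
    run (multiplex r xs as B) z ≡ (if lookup z r then cnots (B (address xs z)) z else z)
  run-multiplex {zero} B dis ok z clear =
    run-controlled (B []) z (All.map (λ (c≢d , d≢r , _) → c≢d , d≢r) (ok []))
  run-multiplex {suc l} {r} {xs} {as} B dis ok z clear = begin
    run (T ++ M true ++ T′ ++ M false ++ T ++ T′) z
      ≡⟨ run-++ T _ z ⟩
    run (M true ++ T′ ++ M false ++ T ++ T′) (run T z)
      ≡⟨ run-++ (M true) _ _ ⟩
    run (T′ ++ M false ++ T ++ T′) (run (M true) (run T z))
      ≡⟨ run-++ T′ _ _ ⟩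
    run (M false ++ T ++ T′) (run T′ (run (M true) (run T z)))
      ≡⟨ run-++ (M false) _ _ ⟩
    run (T ++ T′) (run (M false) (run T′ (run (M true) (run T z))))
      ≡⟨ run-++ T _ _ ⟩
    run T′ (run T (run (M false) (run T′ (run (M true) (run T z)))))
      ≡⟨ cases (lookup z r) (lookup z x) refl refl ⟩
    (if lookup z r then cnots (B (lookup z x ∷ σ)) z else z) ∎
    where
    open ≡-Reasoning
    x = xs zero
    a = as zero
    xs′ = xs ∘ suc
    as′ = as ∘ suc
    T  = toffoli r x a
    T′ = toffoli r r a
    M : Bool → Circuit m
    M b = multiplex a xs′ as′ (B ∘ (b ∷_))
    σ = address xs′ z

    -- Every intermediate state has the form `S v y`, where y is z before or after the selected
    -- wiring. `Like y` collects the lines that the surrounding gates depend on, and both choices of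
    -- y satisfy it.
    S : Bool → 𝔹^ m → 𝔹^ m
    S v y = y [ a ]≔ v

    record Like (y : 𝔹^ m) : Set where
      field
        like-r  : lookup y r ≡ lookup z r
        like-xs : ∀ i → lookup y (xs i) ≡ lookup z (xs i)
        like-as : ∀ i → lookup y (as i) ≡ false
    open Like

    like-z : Like z
    like-z = record { like-r = refl ; like-xs = λ _ → refl ; like-as = clear }

    like-cnots : ∀ b → Like (cnots (B (b ∷ σ)) z)
    like-cnots b = record
      { like-r  = cnots-other (B (b ∷ σ)) z (All.map (λ (_ , d≢r , _) → d≢r) oks)
      ; like-xs = λ i → cnots-other (B (b ∷ σ)) z (All.map (λ (_ , _ , d≢xs , _) → d≢xs i) oks)
      ; like-as = λ i → trans (cnots-other (B (b ∷ σ)) z (All.map (λ (_ , _ , _ , _ , d≢as) → d≢as i) oks))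
                              (clear i)
      }
      where oks = ok (b ∷ σ)

    set-a : ∀ {y} u v w → Like y → u xor v ≡ w → xor-at a v (S u y) ≡ S w y
    set-a {y} u v w _ e = trans (Vec.updateAt-updateAt a y) (Vec.updateAt-cong a (λ _ → e) y)

    on-T : ∀ {y} u w → Like y → u xor (lookup z r ∧ lookup z x) ≡ w → run T (S u y) ≡ S w y
    on-T {y} u w like e = trans (run-toffoli _ (r≢as dis zero) (xs≢as dis zero zero))
      (set-a u _ w like (trans (cong (u xor_) (cong₂ _∧_
        (trans (Vec.lookup∘update′ (r≢as dis zero) y u) (like-r like))
        (trans (Vec.lookup∘update′ (xs≢as dis zero zero) y u) (like-xs like zero)))) e))

    on-T′ : ∀ {y} u w → Like y → u xor lookup z r ≡ w → run T′ (S u y) ≡ S w y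
    on-T′ {y} u w like e = trans (run-toffoli _ (r≢as dis zero) (r≢as dis zero))
      (set-a u _ w like (trans (cong (u xor_) (trans (∧-idem _)
        (trans (Vec.lookup∘update′ (r≢as dis zero) y u) (like-r like)))) e))

    dis′ : Disjoint a xs′ as′
    dis′ = record
      { as-injective = λ e → suc-injective (as-injective dis e)
      ; xs≢as = λ i j → xs≢as dis (suc i) (suc j)
      ; r≢as  = λ j e → contradiction (as-injective dis e) λ () }

    ok′ : ∀ b τ → All (Compatible a xs′ as′) (B (b ∷ τ))
    ok′ b τ = All.map (λ (c≢d , _ , d≢xs , c≢as , d≢as) →
      c≢d , d≢as zero , d≢xs ∘ suc , c≢as ∘ suc , d≢as ∘ suc) (ok (b ∷ τ))

    on-M : ∀ {y} b u → Like y → run (M b) (S u y) ≡ (if u then S u (cnots (B (b ∷ σ)) y) else S u y)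
    on-M {y} b u like = begin
      run (M b) (S u y)
        ≡⟨ run-multiplex (B ∘ (b ∷_)) dis′ (ok′ b) (S u y) clear′ ⟩
      (if lookup (S u y) a then cnots (B (b ∷ address xs′ (S u y))) (S u y) else S u y)
        ≡⟨ cong₂ (λ v τ → if v then cnots (B (b ∷ τ)) (S u y) else S u y)
                 (Vec.lookup∘update a y u) address≡ ⟩
      (if u then cnots (B (b ∷ σ)) (S u y) else S u y)
        ≡⟨ cong (if u then_else S u y) (cnots-≔ (B (b ∷ σ)) u y
             (All.map (λ (_ , _ , _ , c≢as , d≢as) → c≢as zero , d≢as zero) (ok (b ∷ σ)))) ⟩
      (if u then S u (cnots (B (b ∷ σ)) y) else S u y) ∎
      where
      clear′ : ∀ i → lookup (S u y) (as′ i) ≡ false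
      clear′ i = trans (Vec.lookup∘update′ (λ e → contradiction (as-injective dis e) λ ()) y u)
                       (like-as like (suc i))
      address≡ : address xs′ (S u y) ≡ σ
      address≡ = Vec.tabulate-cong λ i →
        trans (Vec.lookup∘update′ (xs≢as dis (suc i) zero) y u) (like-xs like (suc i))

    S-false : ∀ {y} → Like y → S false y ≡ y
    S-false {y} like = Vec.updateAt-id-local a y (sym (like-as like zero))

    trace : ∀ {z₁ z₂ z₃ z₄ z₅ z₆} → run T (S false z) ≡ z₁ → run (M true) z₁ ≡ z₂ →
            run T′ z₂ ≡ z₃ → run (M false) z₃ ≡ z₄ → run T z₄ ≡ z₅ → run T′ z₅ ≡ S false z₆ →
            Like z₆ → run T′ (run T (run (M false) (run T′ (run (M true) (run T z))))) ≡ z₆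
    trace refl refl refl refl refl e like = trans
      (cong (run T′ ∘ run T ∘ run (M false) ∘ run T′ ∘ run (M true) ∘ run T) (sym (S-false like-z)))
      (trans e (S-false like))

    -- The two bits passed to `on-T` and `on-T′` are the scratch bit before and after the gate. It
    -- stays 0 if r = 0, runs through 0, 1, 0, 1, 0 if r = x = 1, and through 0, 0, 1, 1, 0 if r = 1
    -- and x = 0; so at most one half is entered with an active root.
    cases : ∀ b c → lookup z r ≡ b → lookup z x ≡ c →
            run T′ (run T (run (M false) (run T′ (run (M true) (run T z))))) ≡
            (if b then cnots (B (c ∷ σ)) z else z)
    cases false c eb ec = trace
      (on-T false false like-z r∧x) (on-M true false like-z) (on-T′ false false like-z eb)
      (on-M false false like-z) (on-T false false like-z r∧x) (on-T′ false false like-z eb) like-z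
      where r∧x = cong (_∧ lookup z x) eb
    cases true true eb ec = trace
      (on-T false true like-z r∧x) (on-M true true like-z) (on-T′ true false like (cong not eb))
      (on-M false false like) (on-T false true like r∧x) (on-T′ true false like (cong not eb)) like
      where
      r∧x = cong₂ _∧_ eb ec
      like = like-cnots true
    cases true false eb ec = trace
      (on-T false false like-z r∧x) (on-M true false like-z) (on-T′ false true like-z eb)
      (on-M false true like-z) (on-T true true like (cong not r∧x)) (on-T′ true false like (cong not eb)) like
      where
      r∧x = cong₂ _∧_ eb ec
      like = like-cnots false

-- The table circuit for an arbitrary map

module _ {m : ℕ} where

  wires : ∀ {N} → (c d : Fin N → Line {m}) → Wiring
  wires c d = tabulate λ i → c i , d i

  cnots-wires-other : ∀ {N j} (c d : Fin N → Line {m}) z → (∀ i → d i ≢ j) →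
                      lookup (cnots (wires c d) z) j ≡ lookup z j
  cnots-wires-other c d z d≢j = cnots-other (wires c d) z (All.tabulate⁺ d≢j)

  -- Targets are distinct and no source is a target, so no CNOT sees the effect of another: the list
  -- acts as one simultaneous xor.
  cnots-wires : ∀ {N} (c d : Fin N → Line {m}) z → (∀ {i j} → d i ≡ d j → i ≡ j) →
                (∀ i j → c i ≢ d j) → ∀ i →
                lookup (cnots (wires c d) z) (d i) ≡ lookup z (d i) xor lookup z (c i)
  cnots-wires {suc N} c d z d-inj c≢d zero = trans
    (cnots-wires-other (c ∘ suc) (d ∘ suc) _ λ i e → contradiction (d-inj e) λ ())
    (xor-at-self (d zero) (lookup z (c zero)) z)
  cnots-wires {suc N} c d z d-inj c≢d (suc i) = trans
    (cnots-wires (c ∘ suc) (d ∘ suc) _ (λ e → suc-injective (d-inj e)) (λ i j → c≢d (suc i) (suc j)) i)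
    (cong₂ _xor_ (xor-at-other _ z λ e → contradiction (d-inj e) λ ())
                 (xor-at-other _ z (c≢d (suc i) zero)))

-- `one` will carry the constant 1 and is the root of both multiplexers; `blank` carries 0. A table
-- line is numbered by a set of slots, written in binary digits.
data Register (n t : ℕ) : Set where
  input result scratch : Fin n → Register n t
  one blank            : Register n t
  table                : Fin (2 ^ t) → Register n t

private
  bit : Bool → Fin 2
  bit false = zero
  bit true  = suc zero

  unbit : Fin 2 → Bool
  unbit zero    = false
  unbit (suc _) = true

  unbit-bit : ∀ b → unbit (bit b) ≡ b
  unbit-bit false = refl
  unbit-bit true  = refl

index : ∀ {t} → (Fin t → Bool) → Fin (2 ^ t)
index S = funToFin (bit ∘ S)

member : ∀ {t} → Fin (2 ^ t) → Fin t → Bool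
member s j = unbit (finToFun s j)

member-index : ∀ {t} (S : Fin t → Bool) j → member (index S) j ≡ S j
member-index S j = trans (cong unbit (finToFun-funToFin (bit ∘ S) j)) (unbit-bit (S j))

module Construction
  (k l t : ℕ) {m : ℕ} (line : Register (k + l) t → Fin m)
  (line-injective : ∀ {r r′} → line r ≡ line r′ → r ≡ r′)
  (group : 𝔹^ k → ℕ) (slot : 𝔹^ k → Fin t) (point : ℕ → Fin t → 𝔹^ k)
  (point-group-slot : ∀ u → point (group u) (slot u) ≡ u)
  (f : 𝔹^ (k + l) → 𝔹^ (k + l))
  where

  n : ℕ
  n = k + l

  contents : (Fin n → Bool) → (Fin (2 ^ t) → Bool) → (Fin n → Bool) →
             Register n t → Bool
  contents x τ y (input i)   = x i
  contents x τ y (result i)  = y i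
  contents x τ y (scratch i) = false
  contents x τ y one         = true
  contents x τ y blank       = false
  contents x τ y (table s)   = τ s

  record Holds (x : Fin n → Bool) (τ : Fin (2 ^ t) → Bool) (y : Fin n → Bool) (z : 𝔹^ m) : Set where
    constructor holding
    field at : ∀ r → lookup z (line r) ≡ contents x τ y r

  open Holds

  -- At the input u, table line s receives the value of the function that is supported on group g
  -- and is there the indicator of the slot set s. Taking `blank` as the source where this value is
  -- 0 gives every leaf the same shape and the same targets.
  load-wiring : ℕ → 𝔹^ k → Wiring
  load-wiring g u = wires
    (λ s → line (if (group u ≡ᵇ g) ∧ member s (slot u) then one else blank))
    (λ s → line (table s))

  load : ℕ → Circuit m
  load g =
    multiplex (line one) (λ i → line (input (i ↑ˡ l))) (λ i → line (scratch (i ↑ˡ l))) (load-wiring g)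

  -- The table line whose function agrees on group g with the map from u to component i of f (u, v).
  column : ℕ → 𝔹^ l → Fin n → Fin (2 ^ t)
  column g v i = index λ j → lookup (f (point g j Vec.++ v)) i

  inputs results : Fin n → Fin m
  inputs i  = line (input i)
  results i = line (result i)

  use-wiring : ℕ → 𝔹^ l → Wiring
  use-wiring g v = wires (λ i → line (table (column g v i))) results

  use : ℕ → Circuit m
  use g =
    multiplex (line one) (λ i → line (input (k ↑ʳ i))) (λ i → line (scratch (k ↑ʳ i))) (use-wiring g)

  stage : ℕ → Circuit m
  stage g = load g ++ use g ++ load g

  stages : ℕ → Circuit m
  stages zero    = []
  stages (suc g) = stages g ++ stage g

  -- Two of the three rounds of the CNOT swap: the input lines end with the result y, the result
  -- lines with the garbage x xor y. The output permutation can then be the identity.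
  exchange : Circuit m
  exchange = controlled (line one) (wires inputs results)
          ++ controlled (line one) (wires results inputs)

  circuit : ℕ → Circuit m
  circuit p = NOT (line one) ++ stages p ++ exchange

  line-≢ : ∀ {r r′} → r ≢ r′ → line r ≢ line r′
  line-≢ r≢r′ e = r≢r′ (line-injective e)

  switch≢ : ∀ {r : Register n t} b → one ≢ r → blank ≢ r → (if b then one else blank) ≢ r
  switch≢ true  one≢r _       = one≢r
  switch≢ false _     blank≢r = blank≢r

  load-holds : ∀ {τ y z} g u v → Holds (lookup (u Vec.++ v)) τ y z →
    Holds (lookup (u Vec.++ v)) (λ s → τ s xor ((group u ≡ᵇ g) ∧ member s (slot u))) y
          (run (load g) z)
  load-holds {τ} {y} {z} g u v h = subst (Holds _ _ _) (sym run-load) holds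
    where
    xs as : Fin k → Fin m
    xs i = line (input (i ↑ˡ l))
    as i = line (scratch (i ↑ˡ l))
    run-load : run (load g) z ≡ cnots (load-wiring g u) z
    run-load = trans
      (run-multiplex (load-wiring g)
        (record { as-injective = λ e → scratch-injective (line-injective e)
                ; xs≢as = λ _ _ → line-≢ λ ()
                ; r≢as = λ _ → line-≢ λ () })
        (λ u′ → All.tabulate⁺ λ s →
          line-≢ (switch≢ (switch u′ s) (λ ()) (λ ())) , line-≢ (λ ()) , (λ _ → line-≢ λ ()) ,
          (λ _ → line-≢ (switch≢ (switch u′ s) (λ ()) (λ ()))) , (λ _ → line-≢ λ ()))
        z (λ i → at h (scratch (i ↑ˡ l))))
      (cong₂ (λ b σ → if b then cnots (load-wiring g σ) z else z) (at h one)
        (trans (Vec.tabulate-cong λ i → trans (at h (input (i ↑ˡ l))) (Vec.lookup-++ˡ u v i))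
               (Vec.tabulate∘lookup u)))
      where
      switch : 𝔹^ k → Fin (2 ^ t) → Bool
      switch u′ s = (group u′ ≡ᵇ g) ∧ member s (slot u′)
      scratch-injective : ∀ {i j : Fin k} → scratch (i ↑ˡ l) ≡ scratch {t = t} (j ↑ˡ l) → i ≡ j
      scratch-injective {i} {j} e with i ↑ˡ l in ei | j ↑ˡ l in ej
      scratch-injective {i} {j} refl | _ | _ = ↑ˡ-injective l i j (trans ei (sym ej))
    other : ∀ {r} → (∀ s → table s ≢ r) →
            lookup (cnots (load-wiring g u) z) (line r) ≡ contents (lookup (u Vec.++ v)) τ y r
    other {r} ne = trans (cnots-wires-other _ _ z λ s → line-≢ (ne s)) (at h r)
    holds : Holds _ _ _ (cnots (load-wiring g u) z)
    holds .at (input i)   = other λ _ ()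
    holds .at (result i)  = other λ _ ()
    holds .at (scratch i) = other λ _ ()
    holds .at one         = other λ _ ()
    holds .at blank       = other λ _ ()
    holds .at (table s)   = trans
      (cnots-wires _ (λ s → line (table s)) z (λ e → table-injective (line-injective e))
        (λ s′ _ → line-≢ (switch≢ ((group u ≡ᵇ g) ∧ member s′ (slot u)) (λ ()) (λ ()))) s)
      (cong₂ _xor_ (at h (table s)) (on-switch ((group u ≡ᵇ g) ∧ member s (slot u))))
      where
      on-switch : ∀ b → lookup z (line (if b then one else blank)) ≡ b
      on-switch true  = at h one
      on-switch false = at h blank
      table-injective : ∀ {s s′} → table {n} {t} s ≡ table s′ → s ≡ s′
      table-injective refl = refl

  result-injective : ∀ {i j : Fin n} → result {n} {t} i ≡ result j → i ≡ j
  result-injective refl = refl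

  input-injective : ∀ {i j : Fin n} → input {n} {t} i ≡ input j → i ≡ j
  input-injective refl = refl

  use-holds : ∀ {τ y z} g u v → Holds (lookup (u Vec.++ v)) τ y z →
    Holds (lookup (u Vec.++ v)) τ (λ i → y i xor τ (column g v i)) (run (use g) z)
  use-holds {τ} {y} {z} g u v h = subst (Holds _ _ _) (sym run-use) holds
    where
    run-use : run (use g) z ≡ cnots (use-wiring g v) z
    run-use = trans
      (run-multiplex (use-wiring g)
        (record { as-injective = λ e → scratch-injective (line-injective e)
                ; xs≢as = λ _ _ → line-≢ λ ()
                ; r≢as = λ _ → line-≢ λ () })
        (λ v′ → All.tabulate⁺ λ i →
          line-≢ (λ ()) , line-≢ (λ ()) , (λ _ → line-≢ λ ()) ,
          (λ _ → line-≢ λ ()) , (λ _ → line-≢ λ ()))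
        z (λ i → at h (scratch (k ↑ʳ i))))
      (cong₂ (λ b σ → if b then cnots (use-wiring g σ) z else z) (at h one)
        (trans (Vec.tabulate-cong λ i → trans (at h (input (k ↑ʳ i))) (Vec.lookup-++ʳ u v i))
               (Vec.tabulate∘lookup v)))
      where
      scratch-injective : ∀ {i j : Fin l} → scratch (k ↑ʳ i) ≡ scratch {t = t} (k ↑ʳ j) → i ≡ j
      scratch-injective {i} {j} e with k ↑ʳ i in ei | k ↑ʳ j in ej
      scratch-injective {i} {j} refl | _ | _ = ↑ʳ-injective k i j (trans ei (sym ej))
    other : ∀ {r} → (∀ i → result i ≢ r) →
            lookup (cnots (use-wiring g v) z) (line r) ≡ contents (lookup (u Vec.++ v)) τ y r
    other {r} ne = trans (cnots-wires-other _ _ z λ i → line-≢ (ne i)) (at h r)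
    holds : Holds _ _ _ (cnots (use-wiring g v) z)
    holds .at (input i)   = other λ _ ()
    holds .at (result i)  = trans
      (cnots-wires _ results z (λ e → result-injective (line-injective e))
        (λ _ _ → line-≢ λ ()) i)
      (cong₂ _xor_ (at h (result i)) (at h (table (column g v i))))
    holds .at (scratch i) = other λ _ ()
    holds .at one         = other λ _ ()
    holds .at blank       = other λ _ ()
    holds .at (table s)   = other λ _ ()

  holds-cong : ∀ {x x′ τ τ′ y y′ z} → (∀ i → x i ≡ x′ i) → (∀ s → τ s ≡ τ′ s) → (∀ i → y i ≡ y′ i) →
               Holds x τ y z → Holds x′ τ′ y′ z
  holds-cong ex eτ ey h .at (input i)   = trans (at h (input i)) (ex i)
  holds-cong ex eτ ey h .at (result i)  = trans (at h (result i)) (ey i)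
  holds-cong ex eτ ey h .at (scratch i) = at h (scratch i)
  holds-cong ex eτ ey h .at one         = at h one
  holds-cong ex eτ ey h .at blank       = at h blank
  holds-cong ex eτ ey h .at (table s)   = trans (at h (table s)) (eτ s)

  -- If u lies in group g, the line `column g v i` holds its set's bit at `slot u`, which is
  -- component i of f at u and v by `point-group-slot`. Otherwise the whole table is 0 and nothing
  -- is added. The second load cancels the first.
  stage-holds : ∀ {y z} g u v → Holds (lookup (u Vec.++ v)) (const false) y z →
    Holds (lookup (u Vec.++ v)) (const false)
                    (λ i → y i xor ((group u ≡ᵇ g) ∧ lookup (f (u Vec.++ v)) i))
          (run (stage g) z)
  stage-holds {y} {z} g u v h = subst (Holds _ _ _)
    (sym (trans (run-++ (load g) _ z) (run-++ (use g) (load g) _)))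
    (holds-cong (λ _ → refl) (λ s → xor-same ((group u ≡ᵇ g) ∧ member s (slot u)))
      (λ i → cong (y i xor_) (selected i (group u ≡ᵇ g) refl))
      (load-holds g u v (use-holds g u v (load-holds g u v h))))
    where
    selected : ∀ i b → (group u ≡ᵇ g) ≡ b →
               b ∧ member (column g v i) (slot u) ≡ b ∧ lookup (f (u Vec.++ v)) i
    selected i false e = refl
    selected i true  e = trans
      (member-index (λ j → lookup (f (point g j Vec.++ v)) i) (slot u))
      (cong (λ u′ → lookup (f (u′ Vec.++ v)) i)
        (trans (cong (λ h → point h (slot u)) (sym (ℕ.≡ᵇ⇒≡ (group u) g (Equivalence.from T-≡ e))))
               (point-group-slot u)))

  <ᵇ-suc : ∀ a g → (a <ᵇ g) xor (a ≡ᵇ g) ≡ (a <ᵇ suc g)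
  <ᵇ-suc zero    zero    = refl
  <ᵇ-suc zero    (suc g) = refl
  <ᵇ-suc (suc a) zero    = refl
  <ᵇ-suc (suc a) (suc g) = <ᵇ-suc a g

  -- Each u belongs to one group only, so the contributions never cancel and their xor records
  -- whether the group of u has already been treated.
  stages-holds : ∀ {z} g u v → Holds (lookup (u Vec.++ v)) (const false) (const false) z →
    Holds (lookup (u Vec.++ v)) (const false)
                    (λ i → (group u <ᵇ g) ∧ lookup (f (u Vec.++ v)) i)
          (run (stages g) z)
  stages-holds zero u v h = h
  stages-holds {z} (suc g) u v h = subst (Holds _ _ _) (sym (run-++ (stages g) (stage g) z))
    (holds-cong (λ _ → refl) (λ _ → refl)
      (λ i → trans (sym (∧-distribʳ-xor (lookup (f (u Vec.++ v)) i) (group u <ᵇ g) (group u ≡ᵇ g)))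
                   (cong (_∧ lookup (f (u Vec.++ v)) i) (<ᵇ-suc (group u) g)))
      (stage-holds g u v (stages-holds g u v h)))

  exchange-holds : ∀ {x y z} → Holds x (const false) y z →
                   ∀ i → lookup (run exchange z) (line (input i)) ≡ y i
  exchange-holds {x} {y} {z} h i = begin
    lookup (run exchange z) (line (input i))
      ≡⟨ cong (λ z → lookup z (line (input i))) (trans (run-++ (controlled (line one) B) _ z)
           (trans (cong (run (controlled (line one) B′)) z₁≡) z₂≡)) ⟩
    lookup (cnots B′ (cnots B z)) (line (input i))
      ≡⟨ cnots-wires results inputs _ (λ e → input-injective (line-injective e))
           (λ _ _ → line-≢ λ ()) i ⟩
    lookup (cnots B z) (line (input i)) xor lookup (cnots B z) (line (result i))
      ≡⟨ cong₂ _xor_ (cnots-wires-other inputs results z λ j → line-≢ {result j} {input i} λ ())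
           (cnots-wires inputs results z (λ e → result-injective (line-injective e))
             (λ j₁ j₂ → line-≢ {input j₁} {result j₂} λ ()) i) ⟩
    lookup z (line (input i)) xor (lookup z (line (result i)) xor lookup z (line (input i)))
      ≡⟨ cong₂ (λ a b → a xor (b xor a)) (at h (input i)) (at h (result i)) ⟩
    x i xor (y i xor x i)
      ≡⟨ cong (x i xor_) (xor-comm (y i) (x i)) ⟩
    x i xor (x i xor y i)
      ≡⟨ xor-assoc (x i) (x i) (y i) ⟨
    (x i xor x i) xor y i
      ≡⟨ cong (_xor y i) (xor-same (x i)) ⟩
    y i ∎
    where
    open ≡-Reasoning
    B  = wires inputs results
    B′ = wires results inputs
    z₁≡ : run (controlled (line one) B) z ≡ cnots B z
    z₁≡ = trans (run-controlled B z (All.tabulate⁺ λ _ → line-≢ (λ ()) , line-≢ λ ()))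
                (cong (if_then cnots B z else z) (at h one))
    z₂≡ : run (controlled (line one) B′) (cnots B z) ≡ cnots B′ (cnots B z)
    z₂≡ = trans (run-controlled B′ _ (All.tabulate⁺ λ _ → line-≢ (λ ()) , line-≢ λ ()))
                (cong (if_then cnots B′ (cnots B z) else cnots B z)
                  (trans (cnots-wires-other inputs results z λ j → line-≢ {result j} {one} λ ()) (at h one)))

  circuit-computes : ∀ p → (∀ u → (group u <ᵇ p) ≡ true) → ∀ z x →
    (∀ i → lookup z (line (input i)) ≡ lookup x i) →
    (∀ r → (∀ i → input i ≢ r) → lookup z (line r) ≡ false) →
    ∀ i → lookup (run (circuit p) z) (line (input i)) ≡ lookup (f x) i
  circuit-computes p group<p z x on-input clear i with Vec.splitAt k x
  ... | u , v , refl = begin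
    lookup (run (circuit p) z) (line (input i))
      ≡⟨ cong (λ z → lookup z (line (input i)))
           (trans (cong (run (stages p ++ exchange)) (run-NOT (line one) z)) (run-++ (stages p) exchange _)) ⟩
    lookup (run exchange (run (stages p) (xor-at (line one) true z))) (line (input i))
      ≡⟨ exchange-holds (stages-holds p u v start) i ⟩
    (group u <ᵇ p) ∧ lookup (f (u Vec.++ v)) i
      ≡⟨ cong (_∧ lookup (f (u Vec.++ v)) i) (group<p u) ⟩
    lookup (f (u Vec.++ v)) i ∎
    where
    open ≡-Reasoning
    other : ∀ {r} → r ≢ one → (∀ i → input i ≢ r) → lookup (xor-at (line one) true z) (line r) ≡ false
    other {r} r≢one ne = trans (xor-at-other true z (line-≢ r≢one)) (clear r ne)
    start : Holds (lookup (u Vec.++ v)) (const false) (const false) (xor-at (line one) true z)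
    start .at (input i)   = trans (xor-at-other true z (line-≢ λ ())) (on-input i)
    start .at (result i)  = other (λ ()) λ _ ()
    start .at (scratch i) = other (λ ()) λ _ ()
    start .at one         = trans (xor-at-self (line one) true z) (cong (_xor true) (clear one λ _ ()))
    start .at blank       = other (λ ()) λ _ ()
    start .at (table s)   = other (λ ()) λ _ ()

  length-load : ∀ g → length (load g) ≤ 2 ^ k * (4 + 2 ^ t)
  length-load g = ≤-trans (ℕ.m≤m+n _ 4)
    (length-multiplex (line one) _ _ (load-wiring g) (2 ^ t) λ _ → ≤-reflexive (length-tabulate _))

  length-use : ∀ g → length (use g) ≤ 2 ^ l * (4 + n)
  length-use g = ≤-trans (ℕ.m≤m+n _ 4)
    (length-multiplex (line one) _ _ (use-wiring g) n λ _ → ≤-reflexive (length-tabulate _))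

  length-stages : ∀ p → length (stages p) ≤ p * (2 * (2 ^ k * (4 + 2 ^ t)) + 2 ^ l * (4 + n))
  length-stages zero    = z≤n
  length-stages (suc p) = begin
    length (stages p ++ stage p)        ≡⟨ length-++ (stages p) ⟩
    length (stages p) + length (stage p) ≤⟨ +-mono-≤ (length-stages p) length-stage ⟩
    p * C + C                           ≡⟨ ℕ.+-comm (p * C) C ⟩
    suc p * C                           ∎
    where
    open ℕ.≤-Reasoning
    A = 2 ^ k * (4 + 2 ^ t)
    D = 2 ^ l * (4 + n)
    C = 2 * A + D
    rearrange : ∀ a d → a + (d + a) ≡ 2 * a + d
    rearrange = solve-∀
    length-stage : length (stage p) ≤ C
    length-stage = begin
      length (stage p)                                     ≡⟨ length-++ (load p) ⟩
      length (load p) + length (use p ++ load p)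
        ≡⟨ cong (length (load p) +_) (length-++ (use p)) ⟩
      length (load p) + (length (use p) + length (load p))
        ≤⟨ +-mono-≤ (length-load p) (+-mono-≤ (length-use p) (length-load p)) ⟩
      A + (D + A)                                          ≡⟨ rearrange A D ⟩
      C                                                    ∎

  length-circuit : ∀ p → length (circuit p) ≤
                   1 + (p * (2 * (2 ^ k * (4 + 2 ^ t)) + 2 ^ l * (4 + n)) + (n + n))
  length-circuit p = s≤s (≤-trans (≤-reflexive (length-++ (stages p)))
    (+-mono-≤ (length-stages p)
      (≤-trans (≤-reflexive (length-++ (controlled (line one) (wires inputs results))))
      (+-mono-≤ (part inputs results) (part results inputs)))))
    where
    part : (c d : Fin n → Fin m) → length (controlled (line one) (wires c d)) ≤ n
    part c d = ≤-trans (length-controlled (line one) (wires c d)) (≤-reflexive (length-tabulate _))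

-- Placing the registers on the lines

module Layout (n t r : ℕ) where

  spare : ℕ
  spare = n + (n + (2 + 2 ^ t))

  -- The inputs come first, as the initial state demands; the last r lines are idle and absorb any
  -- surplus of ancillas.
  line : Register n t → Fin (n + (spare + r))
  line (input i)   = i ↑ˡ (spare + r)
  line (result i)  = n ↑ʳ ((i ↑ˡ (n + (2 + 2 ^ t))) ↑ˡ r)
  line (scratch i) = n ↑ʳ ((n ↑ʳ (i ↑ˡ (2 + 2 ^ t))) ↑ˡ r)
  line one         = n ↑ʳ ((n ↑ʳ (n ↑ʳ zero)) ↑ˡ r)
  line blank       = n ↑ʳ ((n ↑ʳ (n ↑ʳ suc zero)) ↑ˡ r)
  line (table s)   = n ↑ʳ ((n ↑ʳ (n ↑ʳ suc (suc s))) ↑ˡ r)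

  private
    tail-register : Fin (2 + 2 ^ t) → Register n t
    tail-register zero          = one
    tail-register (suc zero)    = blank
    tail-register (suc (suc s)) = table s

    spare-register : Fin spare → Register n t
    spare-register = [ result , [ scratch , tail-register ]′ ∘ splitAt n ]′ ∘ splitAt n

    -- A left inverse of `line`, from which injectivity follows; `blank` is only a default value on
    -- the idle lines.
    register : Fin (n + (spare + r)) → Register n t
    register = [ input , [ spare-register , const blank ]′ ∘ splitAt spare ]′ ∘ splitAt n

    register-input : ∀ i → register (i ↑ˡ (spare + r)) ≡ input i
    register-input i rewrite splitAt-↑ˡ n i (spare + r) = refl

    register-spare : ∀ j → register (n ↑ʳ (j ↑ˡ r)) ≡ spare-register j
    register-spare j rewrite splitAt-↑ʳ n (spare + r) (j ↑ˡ r) | splitAt-↑ˡ spare j r = refl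

    register-tail : ∀ j → register (n ↑ʳ ((n ↑ʳ (n ↑ʳ j)) ↑ˡ r)) ≡ tail-register j
    register-tail j
      rewrite register-spare (n ↑ʳ (n ↑ʳ j))
            | splitAt-↑ʳ n (n + (2 + 2 ^ t)) (n ↑ʳ j)
            | splitAt-↑ʳ n (2 + 2 ^ t) j = refl

    register-line : ∀ ρ → register (line ρ) ≡ ρ
    register-line (input i)   = register-input i
    register-line (result i)
      rewrite register-spare (i ↑ˡ (n + (2 + 2 ^ t)))
            | splitAt-↑ˡ n i (n + (2 + 2 ^ t)) = refl
    register-line (scratch i)
      rewrite register-spare (n ↑ʳ (i ↑ˡ (2 + 2 ^ t)))
            | splitAt-↑ʳ n (n + (2 + 2 ^ t)) (i ↑ˡ (2 + 2 ^ t))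
            | splitAt-↑ˡ n i (2 + 2 ^ t) = refl
    register-line one         = register-tail zero
    register-line blank       = register-tail (suc zero)
    register-line (table s)   = register-tail (suc (suc s))

  line-injective : ∀ {ρ ρ′} → line ρ ≡ line ρ′ → ρ ≡ ρ′
  line-injective {ρ} {ρ′} e = trans (sym (register-line ρ)) (trans (cong register e) (register-line ρ′))

  initial : 𝔹^ n → 𝔹^ (n + (spare + r))
  initial x = x Vec.++ Vec.replicate (spare + r) false

  initial-input : ∀ x i → lookup (initial x) (line (input i)) ≡ lookup x i
  initial-input x i = Vec.lookup-++ˡ x _ i

  private
    initial-spare : ∀ x j → lookup (initial x) (n ↑ʳ j) ≡ false
    initial-spare x j = trans (Vec.lookup-++ʳ x _ j) (Vec.lookup-replicate j false)

  initial-clear : ∀ x ρ → (∀ i → input i ≢ ρ) → lookup (initial x) (line ρ) ≡ false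
  initial-clear x (input i)   ne = contradiction refl (ne i)
  initial-clear x (result i)  ne = initial-spare x _
  initial-clear x (scratch i) ne = initial-spare x _
  initial-clear x one         ne = initial-spare x _
  initial-clear x blank       ne = initial-spare x _
  initial-clear x (table s)   ne = initial-spare x _

-- Cutting the assignments of the first k variables into groups

module Grouping (k t : ℕ) .{{_ : NonZero t}} where

  private instance
    2^k≢0 : NonZero (2 ^ k)
    2^k≢0 = ℕ.m^n≢0 2 k

  encode : 𝔹^ k → Fin (2 ^ k)
  encode u = index (lookup u)

  decode : Fin (2 ^ k) → 𝔹^ k
  decode s = Vec.tabulate (member s)

  decode-encode : ∀ u → decode (encode u) ≡ u
  decode-encode u = trans (Vec.tabulate-cong (member-index (lookup u))) (Vec.tabulate∘lookup u)

  group : 𝔹^ k → ℕ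
  group u = toℕ (encode u) / t

  slot : 𝔹^ k → Fin t
  slot u = toℕ (encode u) mod t

  point : ℕ → Fin t → 𝔹^ k
  -- The last group may be incomplete. Its surplus slots wrap around modulo 2ᵏ to arbitrary points;
  -- no u has such a slot in that group, so these table bits are never selected.
  point g j = decode ((toℕ j + g * t) mod (2 ^ k))

  point-group-slot : ∀ u → point (group u) (slot u) ≡ u
  point-group-slot u = trans (cong decode (trans (cong (_mod (2 ^ k)) number) (toℕ-mod (encode u))))
                             (decode-encode u)
    where
    number : toℕ (slot u) + group u * t ≡ toℕ (encode u)
    number = trans (cong (_+ group u * t) (toℕ-fromℕ< (m%n<n (toℕ (encode u)) t)))
                   (sym (m≡m%n+[m/n]*n (toℕ (encode u)) t))
    toℕ-mod : ∀ s → toℕ s mod (2 ^ k) ≡ s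
    toℕ-mod s = toℕ-injective (trans (toℕ-fromℕ< (m%n<n (toℕ s) (2 ^ k))) (m<n⇒m%n≡m (toℕ<n s)))

  group<ᵇ : ∀ p → 2 ^ k ≤ p * t → ∀ u → (group u <ᵇ p) ≡ true
  group<ᵇ p 2^k≤pt u = Equivalence.to T-≡
    (ℕ.<⇒<ᵇ (m<n*o⇒m/o<n {toℕ (encode u)} {p} {t} (ℕ.<-≤-trans (toℕ<n (encode u)) 2^k≤pt)))

-- From circuits to a bound on the complexity

cost : (k l t p : ℕ) → ℕ
cost k l t p = 1 + (p * (2 * (2 ^ k * (4 + 2 ^ t)) + 2 ^ l * (4 + (k + l))) + ((k + l) + (k + l)))

implementation : ∀ k l t p r .{{_ : NonZero t}} → 2 ^ k ≤ p * t → ∀ f →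
  let n = k + l ; q = Layout.spare n t r + r in
  ∃[ 𝔖 ] Implements n q 𝔖 f × length 𝔖 ≤ cost k l t p
implementation k l t p r 2^k≤pt f = circuit p , (Perm.id , computes) , length-circuit p
  where
  open Layout (k + l) t r
  open Grouping k t
  open Construction k l t line line-injective group slot point point-group-slot f
  computes : ∀ x → output (k + l) (spare + r) (circuit p) Perm.id x ≡ f x
  computes x = begin
    Vec.take n (Vec.tabulate (lookup z)) ≡⟨ cong (Vec.take n) (Vec.tabulate∘lookup z) ⟩
    Vec.take n z                         ≡⟨ Vec.tabulate∘lookup (Vec.take n z) ⟨
    Vec.tabulate (lookup (Vec.take n z)) ≡⟨ Vec.tabulate-cong (λ i → trans (take-lookup i)
       (circuit-computes p (group<ᵇ p 2^k≤pt) (initial x) x (initial-input x) (initial-clear x) i)) ⟩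
    Vec.tabulate (lookup (f x))          ≡⟨ Vec.tabulate∘lookup (f x) ⟩
    f x                                  ∎
    where
    open ≡-Reasoning
    z = run (circuit p) (initial x)
    take-lookup : ∀ i → lookup (Vec.take n z) i ≡ lookup z (i ↑ˡ (spare + r))
    take-lookup i = trans (sym (Vec.lookup-++ˡ (Vec.take n z) (Vec.drop n z) i))
                          (cong (λ y → lookup y (i ↑ˡ (spare + r))) (Vec.take++drop≡id n z))

-- The maximum L(n, q) is attained by some f, and the circuit given for this f bounds its minimum.
L≤ : ∀ {n q B} → (∀ f → ∃[ 𝔖 ] Implements n q 𝔖 f × length 𝔖 ≤ B) → L n q ≤ B
L≤ {n} {q} h with L-spec n q
... | (f , _ , _ , min) , _ =
  let 𝔖 , imp , len = h f in ≤-trans (min (length 𝔖) (𝔖 , imp , refl)) len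

L≤cost : ∀ {n q} k l t p .{{_ : NonZero t}} → k + l ≡ n → n + (n + (2 + 2 ^ t)) ≤ q → 2 ^ k ≤ p * t →
         L n q ≤ cost k l t p
L≤cost {q = q} k l t p refl room 2^k≤pt =
  subst (λ q → L (k + l) q ≤ cost k l t p) (ℕ.m+[n∸m]≡n room)
    (L≤ (implementation k l t p (q ∸ Layout.spare (k + l) t 0) 2^k≤pt))

-- Counting gates

0<2^ : ∀ n → 0 < 2 ^ n
0<2^ n = ℕ.m^n>0 2 n

2*n≤2^n : ∀ n → 2 * n ≤ 2 ^ n
2*n≤2^n zero          = z≤n
2*n≤2^n (suc zero)    = ≤-refl
2*n≤2^n (suc (suc n)) = begin
  2 * suc (suc n)           ≡⟨ ℕ.*-suc 2 (suc n) ⟩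
  2 + 2 * suc n             ≤⟨ +-mono-≤ (*-monoʳ-≤ 2 (0<2^ n)) (2*n≤2^n (suc n)) ⟩
  2 ^ suc n + 2 ^ suc n     ≡⟨ cong (2 ^ suc n +_) (ℕ.+-identityʳ (2 ^ suc n)) ⟨
  2 ^ suc (suc n)           ∎
  where open ℕ.≤-Reasoning

n≤2^n : ∀ n → n ≤ 2 ^ n
n≤2^n n = ≤-trans (ℕ.m≤m+n n (n + 0)) (2*n≤2^n n)

-- With m = n - c, the hypothesis gives n ≤ 2 m ≤ 2ᵐ.
2^c*n≤2^n : ∀ c {n} → 2 * c ≤ n → 2 ^ c * n ≤ 2 ^ n
2^c*n≤2^n c {n} 2c≤n = begin
  2 ^ c * n             ≤⟨ *-monoʳ-≤ (2 ^ c) n≤2m ⟩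
  2 ^ c * (2 * (n ∸ c)) ≤⟨ *-monoʳ-≤ (2 ^ c) (2*n≤2^n (n ∸ c)) ⟩
  2 ^ c * 2 ^ (n ∸ c)   ≡⟨ ℕ.^-distribˡ-+-* 2 c (n ∸ c) ⟨
  2 ^ (c + (n ∸ c))     ≡⟨ cong (2 ^_) c+m≡n ⟩
  2 ^ n                 ∎
  where
  open ℕ.≤-Reasoning
  c+m≡n : c + (n ∸ c) ≡ n
  c+m≡n = ℕ.m+[n∸m]≡n (≤-trans (ℕ.m≤m+n c (c + 0)) 2c≤n)
  n≤2m : n ≤ 2 * (n ∸ c)
  n≤2m = ℕ.+-cancelˡ-≤ n _ _ (begin
    n + n                     ≡⟨ cong (n +_) (ℕ.+-identityʳ n) ⟨
    2 * n                     ≡⟨ cong (2 *_) c+m≡n ⟨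
    2 * (c + (n ∸ c))         ≡⟨ ℕ.*-distribˡ-+ 2 c (n ∸ c) ⟩
    2 * c + 2 * (n ∸ c)       ≤⟨ ℕ.+-monoˡ-≤ (2 * (n ∸ c)) 2c≤n ⟩
    n + 2 * (n ∸ c)           ∎)

-- The exponent j replaces log₂ n in all integer estimates: it fixes k = a + j and measures how
-- large ⌈n/φ⌉ has to be.
dyadic : ∀ n .{{_ : NonZero n}} → ∃[ j ] n ≤ 2 ^ j × 2 ^ j ≤ 2 * n
dyadic (suc zero)    = 0 , ≤-refl , s≤s z≤n
dyadic (suc (suc n)) with dyadic (suc n)
... | j , n≤2^j , 2^j≤2n with suc (suc n) ℕ.≤? 2 ^ j
...   | yes 1+n≤2^j = j , 1+n≤2^j , ≤-trans 2^j≤2n (*-monoʳ-≤ 2 (ℕ.n≤1+n (suc n)))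
...   | no  1+n≰2^j = suc j , 1+n≤2n , *-monoʳ-≤ 2 (≤-trans 2^j≤n (ℕ.n≤1+n (suc n)))
  where
  2^j≤n : 2 ^ j ≤ suc n
  2^j≤n = ℕ.≤-pred (ℕ.≰⇒> 1+n≰2^j)
  1+n≤2n : suc (suc n) ≤ 2 ^ suc j
  1+n≤2n = ≤-trans (+-mono-≤ (0<2^ j) n≤2^j)
             (≤-reflexive (cong (2 ^ j +_) (sym (ℕ.+-identityʳ (2 ^ j)))))

-- The cost is at most (1 + 5 / M) 2ⁿ.
module CostBound (M E k l t s n p : ℕ) .{{_ : NonZero M}} .{{_ : NonZero n}}
  (k+l≡n : k + l ≡ n) (t+s≡n : t + s ≡ n)
  (Mn≤2^k : M * n ≤ 2 ^ k) (2^k≤2Mn : 2 ^ k ≤ 2 * M * n)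
  (table-small : 160 * (M * M * M) * n ≤ 2 ^ s)
  (t-large : (n + 4) * M ≤ t * (M + 1))
  (n-large : M * (1 + (n + n)) ≤ 2 ^ n)
  (5E≤M : 5 * E ≤ M)
  (pt≤2^k+t : p * t ≤ 2 ^ k + t)
  where
  private
    open ℕ.≤-Reasoning
    K = 2 ^ k
    Λ = 2 ^ l
    T = 2 ^ t
    N = 2 ^ n

    1≤M : 1 ≤ M
    1≤M = >-nonZero⁻¹ M

    t≤n : t ≤ n
    t≤n = ≤-trans (ℕ.m≤m+n t s) (≤-reflexive t+s≡n)

    KΛ≡N : K * Λ ≡ N
    KΛ≡N = trans (sym (ℕ.^-distribˡ-+-* 2 k l)) (cong (2 ^_) k+l≡n)

    Mt≤K : M * t ≤ K
    Mt≤K = ≤-trans (*-monoʳ-≤ M t≤n) Mn≤2^k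

    t≤K : t ≤ K
    t≤K = ≤-trans (ℕ.m≤n*m t M) Mt≤K

  n≤2t : n ≤ 2 * t
  n≤2t = ℕ.*-cancelʳ-≤ n (2 * t) M (begin
    n * M       ≤⟨ *-monoˡ-≤ M (ℕ.m≤m+n n 4) ⟩
    (n + 4) * M ≤⟨ t-large ⟩
    t * (M + 1) ≤⟨ *-monoʳ-≤ t (ℕ.+-monoʳ-≤ M 1≤M) ⟩
    t * (M + M) ≡⟨ lem t M ⟩
    2 * t * M   ∎)
    where
    lem : ∀ t M → t * (M + M) ≡ 2 * t * M
    lem = solve-∀

  private
    p≤8M : p ≤ 8 * M
    p≤8M = ℕ.*-cancelʳ-≤ p (8 * M) n (begin
      p * n           ≤⟨ *-monoʳ-≤ p n≤2t ⟩
      p * (2 * t)     ≡⟨ lem₁ p t ⟩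
      2 * (p * t)     ≤⟨ *-monoʳ-≤ 2 (≤-trans pt≤2^k+t (ℕ.+-monoʳ-≤ K t≤K)) ⟩
      2 * (K + K)     ≤⟨ *-monoʳ-≤ 2 (+-mono-≤ 2^k≤2Mn 2^k≤2Mn) ⟩
      2 * (2 * M * n + 2 * M * n) ≡⟨ lem₂ M n ⟩
      8 * M * n       ∎)
      where
      lem₁ : ∀ p t → p * (2 * t) ≡ 2 * (p * t)
      lem₁ = solve-∀
      lem₂ : ∀ M n → 2 * (2 * M * n + 2 * M * n) ≡ 8 * M * n
      lem₂ = solve-∀

    -- The constant 160 is 8 · 2 · 2 · 5: at most 8 M groups, two loads for each, 2ᵏ ≤ 2 M n leaves,
    -- and 4 + 2ᵗ ≤ 5 · 2ᵗ gates per leaf. The remaining factor M makes the total at most 2ⁿ / M.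
    load-cost : M * (p * (2 * (K * (4 + T)))) ≤ N
    load-cost = begin
      M * (p * (2 * (K * (4 + T)))) ≤⟨ *-monoʳ-≤ M (*-mono-≤ p≤8M (*-monoʳ-≤ 2
                                         (*-mono-≤ 2^k≤2Mn (+-mono-≤ (*-monoʳ-≤ 4 (0<2^ t)) ≤-refl)))) ⟩
      M * (8 * M * (2 * (2 * M * n * (4 * T + T)))) ≡⟨ lem M n T ⟩
      T * (160 * (M * M * M) * n)   ≤⟨ *-monoʳ-≤ T table-small ⟩
      T * 2 ^ s                     ≡⟨ ℕ.^-distribˡ-+-* 2 t s ⟨
      2 ^ (t + s)                   ≡⟨ cong (2 ^_) t+s≡n ⟩
      N                             ∎
      where
      lem : ∀ M n T → M * (8 * M * (2 * (2 * M * n * (4 * T + T)))) ≡ T * (160 * (M * M * M) * n)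
      lem = solve-∀

    -- Two losses of a factor 1 + 1/M: one from (n + 4) / t, where 4 is the branching overhead per
    -- leaf, and one from rounding the number of groups, since t ≤ 2ᵏ / M.
    use-cost : M * M * (p * (Λ * (4 + n))) ≤ (M + 1) * (M + 1) * N
    use-cost = begin
      M * M * (p * (Λ * (4 + n)))         ≡⟨ lem₁ M p Λ n ⟩
      M * p * Λ * ((n + 4) * M)           ≤⟨ *-monoʳ-≤ (M * p * Λ) t-large ⟩
      M * p * Λ * (t * (M + 1))           ≡⟨ lem₂ M p Λ t ⟩
      (M + 1) * M * Λ * (p * t)           ≤⟨ *-monoʳ-≤ ((M + 1) * M * Λ) pt≤2^k+t ⟩
      (M + 1) * M * Λ * (K + t)           ≡⟨ lem₃ M Λ K t ⟩
      (M + 1) * (M * (K * Λ) + M * t * Λ)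
        ≤⟨ *-monoʳ-≤ (M + 1) (ℕ.+-monoʳ-≤ (M * (K * Λ)) (*-monoˡ-≤ Λ Mt≤K)) ⟩
      (M + 1) * (M * (K * Λ) + K * Λ)     ≡⟨ cong (λ x → (M + 1) * (M * x + x)) KΛ≡N ⟩
      (M + 1) * (M * N + N)               ≡⟨ lem₄ M N ⟩
      (M + 1) * (M + 1) * N               ∎
      where
      lem₁ : ∀ M p Λ n → M * M * (p * (Λ * (4 + n))) ≡ M * p * Λ * ((n + 4) * M)
      lem₁ = solve-∀
      lem₂ : ∀ M p Λ t → M * p * Λ * (t * (M + 1)) ≡ (M + 1) * M * Λ * (p * t)
      lem₂ = solve-∀
      lem₃ : ∀ M Λ K t → (M + 1) * M * Λ * (K + t) ≡ (M + 1) * (M * (K * Λ) + M * t * Λ)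
      lem₃ = solve-∀
      lem₄ : ∀ M N → (M + 1) * (M * N + N) ≡ (M + 1) * (M + 1) * N
      lem₄ = solve-∀

    -- In units of 2ⁿ the three parts give 1/M + 1/M + (1 + 1/M)², which is 1 + 4/M + 1/M² ≤ 1 +
    -- 5/M.
    M*cost : M * cost k l t p ≤ (M + 5) * N
    M*cost = ℕ.*-cancelˡ-≤ M (begin
      M * (M * cost k l t p)
        ≡⟨ cong (λ n → M * (M * (1 + (p * (2 * (K * (4 + T)) + Λ * (4 + n)) + (n + n))))) k+l≡n ⟩
      M * (M * (1 + (p * (2 * (K * (4 + T)) + Λ * (4 + n)) + (n + n))))
        ≡⟨ lem₁ M p (2 * (K * (4 + T))) (Λ * (4 + n)) n ⟩
      M * (M * (1 + (n + n))) + M * (M * (p * (2 * (K * (4 + T))))) + M * M * (p * (Λ * (4 + n)))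
        ≤⟨ +-mono-≤ (+-mono-≤ (*-monoʳ-≤ M n-large) (*-monoʳ-≤ M load-cost)) use-cost ⟩
      M * N + M * N + (M + 1) * (M + 1) * N     ≡⟨ lem₂ M N ⟩
      (M * M + 4 * M) * N + 1 * N               ≤⟨ ℕ.+-monoʳ-≤ ((M * M + 4 * M) * N) (*-monoˡ-≤ N 1≤M) ⟩
      (M * M + 4 * M) * N + M * N               ≡⟨ lem₃ M N ⟩
      M * ((M + 5) * N)                         ∎)
      where
      lem₁ : ∀ M p A B n → M * (M * (1 + (p * (A + B) + (n + n)))) ≡
             M * (M * (1 + (n + n))) + M * (M * (p * A)) + M * M * (p * B)
      lem₁ = solve-∀
      lem₂ : ∀ M N → M * N + M * N + (M + 1) * (M + 1) * N ≡ (M * M + 4 * M) * N + 1 * N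
      lem₂ = solve-∀
      lem₃ : ∀ M N → (M * M + 4 * M) * N + M * N ≡ M * ((M + 5) * N)
      lem₃ = solve-∀

  cost-bound : E * cost k l t p ≤ (E + 1) * 2 ^ n
  cost-bound = ℕ.*-cancelˡ-≤ M (begin
    M * (E * cost k l t p) ≡⟨ lem₁ M E (cost k l t p) ⟩
    E * (M * cost k l t p) ≤⟨ *-monoʳ-≤ E M*cost ⟩
    E * ((M + 5) * N)      ≡⟨ lem₂ M E N ⟩
    E * M * N + 5 * E * N  ≤⟨ ℕ.+-monoʳ-≤ (E * M * N) (*-monoˡ-≤ N 5E≤M) ⟩
    E * M * N + M * N      ≡⟨ lem₃ M E N ⟩
    M * ((E + 1) * N)      ∎)
    where
    lem₁ : ∀ M E c → M * (E * c) ≡ E * (M * c)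
    lem₁ = solve-∀
    lem₂ : ∀ M E N → E * ((M + 5) * N) ≡ E * M * N + 5 * E * N
    lem₂ = solve-∀
    lem₃ : ∀ M E N → E * M * N + M * N ≡ M * ((E + 1) * N)
    lem₃ = solve-∀

quotient-cover : ∀ m t .{{_ : NonZero t}} → m ≤ suc (m / t) * t × suc (m / t) * t ≤ m + t
quotient-cover m t = covers , bounded-by
  where
  open ℕ.≤-Reasoning
  covers : m ≤ t + m / t * t
  covers = begin
    m                     ≡⟨ m≡m%n+[m/n]*n m t ⟩
    m % t + m / t * t     ≤⟨ ℕ.+-monoˡ-≤ (m / t * t) (ℕ.<⇒≤ (m%n<n m t)) ⟩
    t + m / t * t         ∎
  bounded-by : t + m / t * t ≤ m + t
  bounded-by = begin
    t + m / t * t         ≤⟨ ℕ.+-monoʳ-≤ t (m/n*n≤m m t) ⟩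
    t + m                 ≡⟨ ℕ.+-comm t m ⟩
    m + t                 ∎

-- Choice of the parameters

module _ {n s q : ℕ} (a E : ℕ) where
  private
    M = 2 ^ a
    t = n ∸ s

  -- Here s is ⌈n/φ⌉. The last three hypotheses are the integer content of the bound on φ, of the
  -- growth of φ beyond 2 (M + 1), and of the asymptotics of q₀. The truncated s - 1 appears because
  -- a ceiling exceeds its real number by less than 1.
  L-bound : 5 * E ≤ M → 10 * M + 2 ≤ n → 2 * (a + 2) ≤ n →
            (∀ j → n ≤ 2 ^ j → 2 ^ j ≤ 2 * n → j + (8 + 3 * a) ≤ s) →
            (s ∸ 1) * (2 * (M + 1)) ≤ n → n * 2 ^ t ≤ 2 * q →
            E * L n q ≤ (E + 1) * 2 ^ n
  L-bound 5E≤M n≥₁ n≥₂ s-large s-small q-large = begin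
    E * L n q            ≤⟨ *-monoʳ-≤ E (L≤cost k l t p k+l≡n room (proj₁ cover)) ⟩
    E * cost k l t p     ≤⟨ CB.cost-bound ⟩
    (E + 1) * 2 ^ n      ∎
    where
    open ℕ.≤-Reasoning

    1≤M : 1 ≤ M
    1≤M = 0<2^ a

    12≤n : 12 ≤ n
    12≤n = ≤-trans (+-mono-≤ (*-monoʳ-≤ 10 1≤M) (≤-refl {2})) n≥₁

    instance
      n≢0 : NonZero n
      n≢0 = >-nonZero (≤-trans (s≤s z≤n) 12≤n)
      M≢0 : NonZero M
      M≢0 = >-nonZero 1≤M

    j = proj₁ (dyadic n)
    n≤2^j = proj₁ (proj₂ (dyadic n))
    2^j≤2n = proj₂ (proj₂ (dyadic n))
    k = a + j
    l = n ∸ k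

    Mn≤2^k : M * n ≤ 2 ^ k
    Mn≤2^k = ≤-trans (*-monoʳ-≤ M n≤2^j) (≤-reflexive (sym (ℕ.^-distribˡ-+-* 2 a j)))

    2^k≤2Mn : 2 ^ k ≤ 2 * M * n
    2^k≤2Mn = begin
      2 ^ k         ≡⟨ ℕ.^-distribˡ-+-* 2 a j ⟩
      M * 2 ^ j     ≤⟨ *-monoʳ-≤ M 2^j≤2n ⟩
      M * (2 * n)   ≡⟨ lem M n ⟩
      2 * M * n     ∎
      where
      lem : ∀ M n → M * (2 * n) ≡ 2 * M * n
      lem = solve-∀

    n-large : M * (1 + (n + n)) ≤ 2 ^ n
    n-large = begin
      M * (1 + (n + n))
        ≤⟨ *-monoʳ-≤ M (ℕ.+-monoˡ-≤ (n + n) (≤-trans (>-nonZero⁻¹ n) (ℕ.m≤m+n n n))) ⟩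
      M * ((n + n) + (n + n)) ≡⟨ lem M n ⟩
      M * 4 * n               ≡⟨ cong (_* n) (ℕ.^-distribˡ-+-* 2 a 2) ⟨
      2 ^ (a + 2) * n         ≤⟨ 2^c*n≤2^n (a + 2) n≥₂ ⟩
      2 ^ n                   ∎
      where
      lem : ∀ M n → M * ((n + n) + (n + n)) ≡ M * 4 * n
      lem = solve-∀

    k≤n : k ≤ n
    k≤n = ℕ.≮⇒≥ λ n<k → ℕ.<-irrefl refl (begin-strict
      2 ^ n              <⟨ ℕ.^-monoʳ-< 2 (s≤s (s≤s z≤n)) n<k ⟩
      2 ^ k              ≤⟨ 2^k≤2Mn ⟩
      2 * M * n          ≡⟨ lem M n ⟩
      M * (n + n)        ≤⟨ *-monoʳ-≤ M (ℕ.n≤1+n (n + n)) ⟩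
      M * (1 + (n + n))  ≤⟨ n-large ⟩
      2 ^ n              ∎)
      where
      lem : ∀ M n → 2 * M * n ≡ M * (n + n)
      lem = solve-∀

    k+l≡n : k + l ≡ n
    k+l≡n = ℕ.m+[n∸m]≡n k≤n

    s≤1+[s∸1] : s ≤ 1 + (s ∸ 1)
    s≤1+[s∸1] = ℕ.m≤n+m∸n s 1

    -- After doubling, 10 M + 2 splits into 2 (M + 1) for the rounding in the ceiling and 8 M for
    -- the four branching gates per leaf.
    s[M+1]+4M≤n : s * (M + 1) + 4 * M ≤ n
    s[M+1]+4M≤n = ℕ.*-cancelˡ-≤ 2 (begin
      2 * (s * (M + 1) + 4 * M)
        ≤⟨ *-monoʳ-≤ 2 (ℕ.+-monoˡ-≤ (4 * M) (*-monoˡ-≤ (M + 1) s≤1+[s∸1])) ⟩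
      2 * ((1 + (s ∸ 1)) * (M + 1) + 4 * M)          ≡⟨ lem (s ∸ 1) M ⟩
      (s ∸ 1) * (2 * (M + 1)) + (10 * M + 2)         ≤⟨ +-mono-≤ s-small n≥₁ ⟩
      n + n                                          ≡⟨ cong (n +_) (ℕ.+-identityʳ n) ⟨
      2 * n                                          ∎)
      where
      lem : ∀ s M → 2 * ((1 + s) * (M + 1) + 4 * M) ≡ s * (2 * (M + 1)) + (10 * M + 2)
      lem = solve-∀

    s<n : s < n
    s<n = begin-strict
      s                       ≤⟨ ℕ.m≤m*n s (M + 1) {{>-nonZero (ℕ.m≤n+m 1 M)}} ⟩
      s * (M + 1)             <⟨ ℕ.m<m+n (s * (M + 1)) (≤-trans 1≤M (ℕ.m≤n*m M 4)) ⟩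
      s * (M + 1) + 4 * M     ≤⟨ s[M+1]+4M≤n ⟩
      n                       ∎

    t+s≡n : t + s ≡ n
    t+s≡n = ℕ.m∸n+n≡m (ℕ.<⇒≤ s<n)

    t-large : (n + 4) * M ≤ t * (M + 1)
    t-large = ℕ.+-cancelʳ-≤ (s * (M + 1)) _ _ (begin
      (n + 4) * M + s * (M + 1)   ≡⟨ lem₁ n M (s * (M + 1)) ⟩
      n * M + (s * (M + 1) + 4 * M) ≤⟨ ℕ.+-monoʳ-≤ (n * M) s[M+1]+4M≤n ⟩
      n * M + n                   ≡⟨ lem₂ n M ⟩
      n * (M + 1)                 ≡⟨ cong (_* (M + 1)) t+s≡n ⟨
      (t + s) * (M + 1)           ≡⟨ ℕ.*-distribʳ-+ (M + 1) t s ⟩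
      t * (M + 1) + s * (M + 1)   ∎)
      where
      lem₁ : ∀ n M x → (n + 4) * M + x ≡ n * M + (x + 4 * M)
      lem₁ = solve-∀
      lem₂ : ∀ n M → n * M + n ≡ n * (M + 1)
      lem₂ = solve-∀

    table-small : 160 * (M * M * M) * n ≤ 2 ^ s
    table-small = begin
      -- Rounding 160 up to 2 ^ 8 turns the whole bound into a power of two, whence the exponent 8 +
      -- 3 a.
      160 * (M * M * M) * n           ≤⟨ *-mono-≤ (*-monoˡ-≤ (M * M * M) (ℕ.m≤m+n 160 96)) n≤2^j ⟩
      256 * (M * M * M) * 2 ^ j       ≡⟨ cong (λ x → 256 * x * 2 ^ j) M³ ⟩
      2 ^ 8 * 2 ^ (3 * a) * 2 ^ j     ≡⟨ cong (_* 2 ^ j) (ℕ.^-distribˡ-+-* 2 8 (3 * a)) ⟨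
      2 ^ (8 + 3 * a) * 2 ^ j         ≡⟨ ℕ.*-comm (2 ^ (8 + 3 * a)) (2 ^ j) ⟩
      2 ^ j * 2 ^ (8 + 3 * a)         ≡⟨ ℕ.^-distribˡ-+-* 2 j (8 + 3 * a) ⟨
      2 ^ (j + (8 + 3 * a))           ≤⟨ ℕ.^-monoʳ-≤ 2 (s-large j n≤2^j 2^j≤2n) ⟩
      2 ^ s                           ∎
      where
      M³ : M * M * M ≡ 2 ^ (3 * a)
      M³ = trans (lem M) (trans (ℕ.^-*-assoc 2 a 3) (cong (2 ^_) (ℕ.*-comm a 3)))
        where
        lem : ∀ M → M * M * M ≡ M * (M * (M * 1))
        lem = solve-∀

    instance
      t≢0 : NonZero t
      t≢0 = >-nonZero (ℕ.m<n⇒0<n∸m s<n)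

    -- One more than the quotient even if t divides 2ᵏ; the surplus of at most t points is already
    -- covered by the rounding loss in `use-cost`.
    p = suc (2 ^ k / t)
    cover = quotient-cover (2 ^ k) t

    module CB = CostBound M E k l t s n p k+l≡n t+s≡n Mn≤2^k 2^k≤2Mn table-small
                          t-large n-large 5E≤M (proj₂ cover)

    12≤2^t : 12 ≤ 2 ^ t
    12≤2^t = ≤-trans 12≤n (≤-trans CB.n≤2t (2*n≤2^n t))

    room : n + (n + (2 + 2 ^ t)) ≤ q
    room = ℕ.*-cancelˡ-≤ 2 (begin
      2 * (n + (n + (2 + 2 ^ t)))       ≡⟨ lem₁ n (2 ^ t) ⟩
      4 * n + 4 + 2 * 2 ^ t             ≤⟨ ℕ.*-cancelˡ-≤ 2 doubled ⟩
      n * 2 ^ t                         ≤⟨ q-large ⟩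
      2 * q                             ∎)
      where
      lem₁ : ∀ n T → 2 * (n + (n + (2 + T))) ≡ 4 * n + 4 + 2 * T
      lem₁ = solve-∀
      -- Doubling provides two copies of n · 2ᵗ: one is reduced to 12 n by 12 ≤ 2ᵗ, the other to 12
      -- · 2ᵗ by 12 ≤ n.
      doubled : 2 * (4 * n + 4 + 2 * 2 ^ t) ≤ 2 * (n * 2 ^ t)
      doubled = begin
        2 * (4 * n + 4 + 2 * 2 ^ t)        ≡⟨ lem₂ n (2 ^ t) ⟩
        n * 8 + 8 + 4 * 2 ^ t
          ≤⟨ +-mono-≤ (ℕ.+-monoʳ-≤ (n * 8) 8≤4n) (*-monoˡ-≤ (2 ^ t) (ℕ.m≤m+n 4 8)) ⟩
        n * 8 + n * 4 + 12 * 2 ^ t         ≡⟨ cong (_+ 12 * 2 ^ t) (ℕ.*-distribˡ-+ n 8 4) ⟨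
        n * 12 + 12 * 2 ^ t                ≤⟨ +-mono-≤ (*-monoʳ-≤ n 12≤2^t) (*-monoˡ-≤ (2 ^ t) 12≤n) ⟩
        n * 2 ^ t + n * 2 ^ t              ≡⟨ cong (n * 2 ^ t +_) (ℕ.+-identityʳ (n * 2 ^ t)) ⟨
        2 * (n * 2 ^ t)                    ∎
        where
        lem₂ : ∀ n T → 2 * (4 * n + 4 + 2 * T) ≡ n * 8 + 8 + 4 * T
        lem₂ = solve-∀
        8≤4n : 8 ≤ n * 4
        8≤4n = *-mono-≤ (≤-trans (s≤s (s≤s z≤n)) 12≤n) (≤-refl {4})

-- Rational approximations

ι : ℕ → ℚ
ι k = ℤ.+ k ℚ./ 1

ι-mkℚ : ∀ k → ι k ≡ mkℚ (ℤ.+ k) 0 (Coprimality.sym (Coprimality.1-coprimeTo k))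
ι-mkℚ k = ℚ.normalize-coprime (Coprimality.sym (Coprimality.1-coprimeTo k))

ι-< : ∀ {a b} → a < b → ι a ℚ.< ι b
ι-< {a} {b} a<b rewrite ι-mkℚ a | ι-mkℚ b =
  ℚ.*<* (subst₂ ℤ._<_ (sym (ℤ.*-identityʳ (ℤ.+ a))) (sym (ℤ.*-identityʳ (ℤ.+ b))) (ℤ.+<+ a<b))

ι-≤ : ∀ {a b} → a ≤ b → ι a ℚ.≤ ι b
ι-≤ {a} {b} a≤b rewrite ι-mkℚ a | ι-mkℚ b =
  ℚ.*≤* (subst₂ ℤ._≤_ (sym (ℤ.*-identityʳ (ℤ.+ a))) (sym (ℤ.*-identityʳ (ℤ.+ b))) (ℤ.+≤+ a≤b))

ι-cancel-< : ∀ {a b} → ι a ℚ.< ι b → a < b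
ι-cancel-< ιa<ιb = ℕ.≰⇒> λ b≤a → ℚ.<-irrefl refl (ℚ.<-≤-trans ιa<ιb (ι-≤ b≤a))

ι-+ : ∀ a b → ι (a + b) ≡ ι a ℚ.+ ι b
ι-+ a b rewrite ι-mkℚ a | ι-mkℚ b =
  cong (ℚ._/ 1) (sym (cong₂ ℤ._+_ (ℤ.*-identityʳ (ℤ.+ a)) (ℤ.*-identityʳ (ℤ.+ b))))

ι-* : ∀ a b → ι (a * b) ≡ ι a ℚ.* ι b
ι-* a b rewrite ι-mkℚ a | ι-mkℚ b = cong (ℚ._/ 1) (ℤ.pos-* a b)

ι-^ : ∀ k → 2ℚ ^ℚ k ≡ ι (2 ^ k)
ι-^ zero    = refl
ι-^ (suc k) = trans (cong (2ℚ ℚ.*_) (ι-^ k)) (sym (ι-* 2 (2 ^ k)))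

0≤ι : ∀ k → 0ℚ ℚ.≤ ι k
0≤ι k = ι-≤ {0} {k} z≤n

ι-nonNeg : ∀ k → ℚ.NonNegative (ι k)
ι-nonNeg k = ℚ.nonNegative (0≤ι k)

ι-pos : ∀ k .{{_ : NonZero k}} → ℚ.Positive (ι k)
ι-pos k = ℚ.positive (ι-< (>-nonZero⁻¹ k))

/-*-ι : ∀ a b .{{_ : NonZero b}} → (ℤ.+ a ℚ./ b) ℚ.* ι b ≡ ι a
/-*-ι a b@(suc b-1) = ℚ.toℚᵘ-injective (begin
  ℚ.toℚᵘ ((ℤ.+ a ℚ./ b) ℚ.* ι b)
    ≈⟨ ℚ.toℚᵘ-homo-* (ℤ.+ a ℚ./ b) (ι b) ⟩
  ℚ.toℚᵘ (ℤ.+ a ℚ./ b) ℚᵘ.* ℚ.toℚᵘ (ι b)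
    ≈⟨ ℚᵘ.*-cong (ℚ.toℚᵘ-fromℚᵘ (ℚᵘ.mkℚᵘ (ℤ.+ a) b-1)) (ℚ.toℚᵘ-fromℚᵘ (ℚᵘ.mkℚᵘ (ℤ.+ b) 0)) ⟩
  ℚᵘ.mkℚᵘ (ℤ.+ a) b-1 ℚᵘ.* ℚᵘ.mkℚᵘ (ℤ.+ b) 0
    ≈⟨ ℚᵘ.*≡* (trans (ℤ.*-identityʳ (ℤ.+ a ℤ.* ℤ.+ b)) (cong (ℤ.+ a ℤ.*_) (cong ℤ.+_ (sym (ℕ.*-identityʳ b))))) ⟩
  ℚᵘ.mkℚᵘ (ℤ.+ a) 0
    ≈⟨ ℚ.toℚᵘ-fromℚᵘ (ℚᵘ.mkℚᵘ (ℤ.+ a) 0) ⟨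
  ℚ.toℚᵘ (ι a) ∎)
  where open ℚᵘ.≃-Reasoning

-p≤∣p∣ : ∀ p → ℚ.- p ℚ.≤ ℚ.∣ p ∣
-p≤∣p∣ p = subst (ℚ.- p ℚ.≤_) (ℚ.∣-p∣≡∣p∣ p) (lemma (ℚ.- p))
  where
  lemma : ∀ q → q ℚ.≤ ℚ.∣ q ∣
  lemma q with ℚ.≤-total 0ℚ q
  ... | inj₁ 0≤q = ℚ.≤-reflexive (sym (ℚ.0≤p⇒∣p∣≡p 0≤q))
  ... | inj₂ q≤0 = ℚ.≤-trans q≤0 (ℚ.0≤∣p∣ q)

∣p-1∣<½⇒½<p : ∀ p → ℚ.∣ p ℚ.- 1ℚ ∣ ℚ.< ½ → ½ ℚ.< p
∣p-1∣<½⇒½<p p close = subst (½ ℚ.<_) p-1+1≡p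
  (ℚ.+-monoˡ-< 1ℚ (subst (ℚ.- ½ ℚ.<_) (neg-involutive (p ℚ.- 1ℚ))
    (ℚ.neg-antimono-< (ℚ.≤-<-trans (-p≤∣p∣ (p ℚ.- 1ℚ)) close))))
  where
  p-1+1≡p : (p ℚ.- 1ℚ) ℚ.+ 1ℚ ≡ p
  p-1+1≡p = trans (ℚ.+-assoc p (ℚ.- 1ℚ) 1ℚ) (ℚ.+-identityʳ p)
  neg-involutive : ∀ q → ℚ.- (ℚ.- q) ≡ q
  neg-involutive (mkℚ (ℤ.+ zero)  _ _) = refl
  neg-involutive (mkℚ (ℤ.+ suc _) _ _) = refl
  neg-involutive (mkℚ -[1+ _ ]  _ _) = refl

half-bound : ∀ a b .{{_ : NonZero b}} → ℚ.∣ (ℤ.+ a ℚ./ b) ℚ.- 1ℚ ∣ ℚ.< ½ → b ≤ 2 * a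
half-bound a b close = ℕ.<⇒≤ (ι-cancel-< (subst₂ ℚ._<_ left right
  (ℚ.*-monoʳ-<-pos 2ℚ (ℚ.*-monoˡ-<-pos (ι b) {{ι-pos b}} (∣p-1∣<½⇒½<p (ℤ.+ a ℚ./ b) close)))))
  where
  left : 2ℚ ℚ.* (½ ℚ.* ι b) ≡ ι b
  left = trans (sym (ℚ.*-assoc 2ℚ ½ (ι b))) (ℚ.*-identityˡ (ι b))
  right : 2ℚ ℚ.* ((ℤ.+ a ℚ./ b) ℚ.* ι b) ≡ ι (2 * a)
  right = trans (cong (2ℚ ℚ.*_) (/-*-ι a b)) (sym (ι-* 2 a))

archimedean : ∀ ε → 0ℚ ℚ.< ε → ∃[ E ] 1ℚ ℚ.< ι E ℚ.* ε
archimedean ε@(mkℚ (ℤ.+ zero) _ _) ε>0 = contradiction (ℚ.positive ε>0) λ ()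
archimedean (mkℚ -[1+ _ ] _ _) ε>0 = contradiction (ℚ.positive ε>0) λ ()
-- Twice the denominator turns ε into twice its numerator, which is at least 2.
archimedean ε@(mkℚ (ℤ.+ suc p) d-1 _) ε>0 = 2 * d , subst (1ℚ ℚ.<_) (sym eq) (ι-< {1} {2 * suc p} 1<2*)
  where
  open ≡-Reasoning
  d = suc d-1
  1<2* : 1 < 2 * suc p
  1<2* = ℕ.*-monoʳ-≤ 2 (s≤s (z≤n {p}))
  eq : ι (2 * d) ℚ.* ε ≡ ι (2 * suc p)
  eq = begin
    ι (2 * d) ℚ.* ε              ≡⟨ ℚ.*-comm (ι (2 * d)) ε ⟩
    ε ℚ.* ι (2 * d)              ≡⟨ cong (λ k → ε ℚ.* ι k) (ℕ.*-comm 2 d) ⟩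
    ε ℚ.* ι (d * 2)              ≡⟨ cong (ε ℚ.*_) (ι-* d 2) ⟩
    ε ℚ.* (ι d ℚ.* ι 2)          ≡⟨ ℚ.*-assoc ε (ι d) (ι 2) ⟨
    (ε ℚ.* ι d) ℚ.* ι 2          ≡⟨ cong (λ q → (q ℚ.* ι d) ℚ.* ι 2) (ℚ.↥p/↧p≡p ε) ⟨
    ((ℤ.+ suc p ℚ./ d) ℚ.* ι d) ℚ.* ι 2 ≡⟨ cong (ℚ._* ι 2) (/-*-ι (suc p) d) ⟩
    ι (suc p) ℚ.* ι 2            ≡⟨ ι-* (suc p) 2 ⟨
    ι (suc p * 2)                ≡⟨ cong ι (ℕ.*-comm (suc p) 2) ⟩
    ι (2 * suc p)                ∎

-- E · a / b ≤ E + 1 < E + E ε, and E is cancelled.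
ratio-bound : ∀ {E ε a b} .{{_ : NonZero b}} → 1ℚ ℚ.< ι E ℚ.* ε → E * a ≤ (E + 1) * b →
              (ℤ.+ a ℚ./ b) ℚ.< 1ℚ ℚ.+ ε
ratio-bound {E} {ε} {a} {b} 1<Eε Ea≤ = ℚ.*-cancelˡ-<-nonNeg (ι E) {{ι-nonNeg E}} (begin-strict
  ι E ℚ.* x               ≤⟨ ℚ.*-cancelʳ-≤-pos (ι b) {{ι-pos b}} scaled ⟩
  ι (E + 1)               ≡⟨ ι-+ E 1 ⟩
  ι E ℚ.+ 1ℚ              <⟨ ℚ.+-monoʳ-< (ι E) 1<Eε ⟩
  ι E ℚ.+ ι E ℚ.* ε       ≡⟨ cong (ℚ._+ ι E ℚ.* ε) (ℚ.*-identityʳ (ι E)) ⟨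
  ι E ℚ.* 1ℚ ℚ.+ ι E ℚ.* ε ≡⟨ ℚ.*-distribˡ-+ (ι E) 1ℚ ε ⟨
  ι E ℚ.* (1ℚ ℚ.+ ε)      ∎)
  where
  open ℚ.≤-Reasoning
  x = ℤ.+ a ℚ./ b
  scaled : ι E ℚ.* x ℚ.* ι b ℚ.≤ ι (E + 1) ℚ.* ι b
  scaled = begin
    ι E ℚ.* x ℚ.* ι b   ≡⟨ ℚ.*-assoc (ι E) x (ι b) ⟩
    ι E ℚ.* (x ℚ.* ι b) ≡⟨ cong (ι E ℚ.*_) (/-*-ι a b) ⟩
    ι E ℚ.* ι a         ≡⟨ ι-* E a ⟨
    ι (E * a)           ≤⟨ ι-≤ Ea≤ ⟩
    ι ((E + 1) * b)     ≡⟨ ι-* (E + 1) b ⟩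
    ι (E + 1) ℚ.* ι b   ∎

-- Reading the real hypotheses as integer inequalities

log₂-lower : ∀ {x a} (x>0 : Positive x) k → lower x a → ι (2 ^ k) ℚ.< a →
             ∀ {r} → r ℚ.< ι k → lower (log₂ x x>0) r
log₂-lower {a = a} x>0 k a∈ 2^k<a {r} r<k =
  mkℚ (ℤ.+ k) 0 (Coprimality.sym (Coprimality.1-coprimeTo k)) , a ,
  subst (r ℚ.<_) (ι-mkℚ k) r<k , ℚ.≤-<-trans (0≤ι (2 ^ k)) 2^k<a , a∈ ,
  subst₂ ℚ._<_ (sym (ι-^ k)) (sym (ℚ.*-identityʳ a)) 2^k<a

-- Strictness of cuts costs whole units: from 2ʲ ≤ 2 n the proof places j - 3 below log₂ n, from ψ >
-- 2 ^ (C + 5) it places C + 4 below log₂ ψ, and the last unit makes the sum exceed j + C strictly.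
-- The bound 5 ≤ n forces j ≥ 3.
log-sum-lower : ∀ {n ψ} (n>0 : Positive (fromℕ n)) (ψ>0 : Positive ψ) C j → 5 ≤ n →
                n ≤ 2 ^ j → 2 ^ j ≤ 2 * n → fromℕ (suc (2 ^ (C + 5))) <ᴿ ψ →
                lower (log₂ (fromℕ n) n>0 +ᴿ log₂ ψ ψ>0) (ι (j + C))
log-sum-lower n>0 ψ>0 C 0 5≤n n≤2^j = contradiction (≤-trans 5≤n n≤2^j) (ℕ.<⇒≱ (ℕ.m≤m+n 2 3))
log-sum-lower n>0 ψ>0 C 1 5≤n n≤2^j = contradiction (≤-trans 5≤n n≤2^j) (ℕ.<⇒≱ (ℕ.m≤m+n 3 2))
log-sum-lower n>0 ψ>0 C 2 5≤n n≤2^j = contradiction (≤-trans 5≤n n≤2^j) (ℕ.<⇒≱ (ℕ.m≤m+n 5 0))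
log-sum-lower {n} {ψ} n>0 ψ>0 C (suc (suc (suc i))) 5≤n _ 2^j≤2n (r , r∈ , r≮) =
  ι i , ι (C + 4) ,
  log₂-lower {fromℕ n} n>0 (suc i) (proj₂ (proj₂ mid)) (proj₁ (proj₂ mid)) (ι-< (ℕ.n<1+n i)) ,
  log₂-lower {ψ} ψ>0 (C + 5) r∈ (ℚ.<-≤-trans (ι-< (ℕ.n<1+n (2 ^ (C + 5)))) (ℚ.≮⇒≥ r≮))
             (ι-< (ℕ.+-monoʳ-< C (ℕ.n<1+n 4))) ,
  subst (ι (3 + i + C) ℚ.<_) (ι-+ i (C + 4)) (ι-< (ℕ.≤-reflexive (lem i C)))
  where
  lem : ∀ i C → suc (3 + i + C) ≡ i + (C + 4)
  lem = solve-∀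
  2^<n : 2 ^ suc i < n
  2^<n = ℕ.<-≤-trans (ℕ.m<m+n (2 ^ suc i) (ℕ.m≤n⇒m≤n+o 0 (ℕ.m^n>0 2 (suc i)))) (ℕ.*-cancelˡ-≤ 2 2^j≤2n)
  mid = ℚ.<-dense (ι-< 2^<n)

-- Since c < D, the rational b = n / c is an upper bound of φ. If s < c, then s · b < n puts s
-- strictly below n / φ, against n / φ ≤ s.
ceiling-≥ : ∀ {n s c φ D} .{{_ : NonZero n}} (D>0 : Positive D) (φ>0 : Positive φ) →
            φ ≤ᴿ n /ᴿ D by D>0 → lower D (ι c) → (n /ᴿ φ by φ>0) ≤ᴿ fromℕ s → c ≤ s
ceiling-≥ {n} {s} {c} {φ} {D} D>0 φ>0 φ≤n/D c∈D n/φ≤s = ℕ.≮⇒≥ λ s<c → absurd s<c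
  where
  absurd : ¬ (s < c)
  absurd s<c = ℚ.<-irrefl refl (n/φ≤s {ι s} (b , b∉φ , sb<n))
    where
    instance
      c≢0 : NonZero c
      c≢0 = >-nonZero (≤-trans (s≤s z≤n) s<c)
    b = ℤ.+ n ℚ./ c
    b>0 : 0ℚ ℚ.< b
    b>0 = ℚ.*-cancelʳ-<-nonNeg (ι c) {{ι-nonNeg c}}
      (subst₂ ℚ._<_ (sym (ℚ.*-zeroˡ (ι c))) (sym (/-*-ι n c)) (ι-< (>-nonZero⁻¹ n)))
    b∉φ : ¬ lower φ b
    b∉φ b∈φ with φ≤n/D b∈φ
    ... | d , d∉D , bd<n = ℚ.<-irrefl (/-*-ι n c)
      (ℚ.<-trans (ℚ.*-monoʳ-<-pos b {{ℚ.positive b>0}} (below-bound D c∈D d∉D)) bd<n)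
    sb<n : ι s ℚ.* b ℚ.< ι n
    sb<n = subst (ι s ℚ.* b ℚ.<_) (trans (ℚ.*-comm (ι c) b) (/-*-ι n c))
      (ℚ.*-monoˡ-<-pos b {{ℚ.positive b>0}} (ι-< s<c))

-- For s > 0 this is s - 1 < n / φ combined with φ > K, through a rational b that bounds φ from
-- above.
ceiling-≤ : ∀ {n s K φ} (φ>0 : Positive φ) → fromℕ K <ᴿ φ → fromℤ (ℤ.+ s ℤ.- ℤ.+ 1) <ᴿ (n /ᴿ φ by φ>0) →
            (s ∸ 1) * K ≤ n
ceiling-≤ {s = zero} _ _ _ = z≤n
ceiling-≤ {n} {suc s} {K} {φ} φ>0 (r , r∈ , r≮K) (r′ , (b , b∉ , r′b<n) , r′≮s) =
  ℕ.<⇒≤ (ι-cancel-< (begin-strict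
    ι (s * K)       ≡⟨ ι-* s K ⟩
    ι s ℚ.* ι K     ≤⟨ ℚ.*-monoˡ-≤-nonNeg (ι s) {{ι-nonNeg s}} K≤b ⟩
    ι s ℚ.* b       ≤⟨ ℚ.*-monoʳ-≤-nonNeg b {{ℚ.nonNegative (ℚ.≤-trans (0≤ι K) K≤b)}} (ℚ.≮⇒≥ r′≮s) ⟩
    r′ ℚ.* b        <⟨ r′b<n ⟩
    ι n             ∎))
  where
  open ℚ.≤-Reasoning
  K≤b : ι K ℚ.≤ b
  K≤b = ℚ.≤-trans (ℚ.≮⇒≥ r≮K) (ℚ.<⇒≤ (below-bound φ r∈ b∉))

eventually-× : ∀ {a b} {P : ℕ → Set a} {Q : ℕ → Set b} →
               Eventually P → Eventually Q → Eventually λ n → P n × Q n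
eventually-× (M , p) (N , q) = M ⊔ N , λ n M⊔N≤n →
  p n (ℕ.m⊔n≤o⇒m≤o M N M⊔N≤n) , q n (ℕ.m⊔n≤o⇒n≤o M N M⊔N≤n)

eventually-map : ∀ {a b} {P : ℕ → Set a} {Q : ℕ → Set b} →
                 (∀ n → P n → Q n) → Eventually P → Eventually Q
eventually-map f (N , p) = N , λ n N≤n → f n (p n N≤n)

eventually-≥ : ∀ N → Eventually (N ≤_)
eventually-≥ N = N , λ _ N≤n → N≤n

theorem4p2 : (φ ψ : ℕ → ℝ) → Growing φ → Growing ψ →
    Eventually (λ n →
    Σ[ n>0 ∈ Positive (fromℕ n) ] Σ[ ψ>0 ∈ Positive (ψ n) ]
    Σ[ d>0 ∈ Positive (log₂ (fromℕ n) n>0 +ᴿ log₂ (ψ n) ψ>0) ]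
    φ n ≤ᴿ n /ᴿ (log₂ (fromℕ n) n>0 +ᴿ log₂ (ψ n) ψ>0) by d>0) →
    (⌈n/φ⌉ : ℕ → ℕ) →
    Eventually (λ n →
    Σ[ φ>0 ∈ Positive (φ n) ] IsCeiling (n /ᴿ φ n by φ>0) (⌈n/φ⌉ n)) →
    (q₀ : ℕ → ℕ) → q₀ ~ (λ n → n * 2 ^ (n ∸ ⌈n/φ⌉ n)) →
    (λ n → L n (q₀ n)) ≲ (λ n → 2 ^ n)
theorem4p2 φ ψ φ-grows ψ-grows φ-bound s ceilings q₀ q₀~ ε ε>0 = eventually-map conclude
  (eventually-× (eventually-× φ-bound ceilings)
  (eventually-× (eventually-× (φ-grows (2 * (2 ^ a + 1))) (ψ-grows (suc (2 ^ (C + 5)))))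
  -- Tolerance ½ yields n · 2ᵗ ≤ 2 q₀, and the factor n leaves room for the table and the 2 n + 2
  -- other ancillas.
  (eventually-× (q₀~ ½ (ℚ.positive⁻¹ ½))
  (eventually-× (eventually-≥ (10 * 2 ^ a + 2)) (eventually-≥ (2 * (a + 2)))))))
  where
  E = proj₁ (archimedean ε ε>0)
  -- This makes M = 2 ^ a at least 5 E, so that the excess 5 / M is at most 1 / E.
  a = 5 * E
  C = 8 + 3 * a
  conclude : ∀ n → _ → Σ[ N≢0 ∈ NonZero (2 ^ n) ] (ℚ._/_ (ℤ.+ L n (q₀ n)) (2 ^ n) {{N≢0}}) ℚ.< 1ℚ ℚ.+ ε
  conclude n (((n>0 , ψ>0 , d>0 , φ≤n/d) , φ>0 , s-1<n/φ , n/φ≤s) , (K<φ , M<ψ) ,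
              (N≢0 , close) , n≥₁ , n≥₂) =
    ℕ.m^n≢0 2 n , ratio-bound {E} {{ℕ.m^n≢0 2 n}} (proj₂ (archimedean ε ε>0))
      (L-bound {s = s n} a E (n≤2^n a) n≥₁ n≥₂
        (λ j n≤2^j 2^j≤2n → ceiling-≥ {n} {s n} {j + C} {φ n}
          {log₂ (fromℕ n) n>0 +ᴿ log₂ (ψ n) ψ>0} {{n≢0}} d>0 φ>0 φ≤n/d
          (log-sum-lower {n} {ψ n} n>0 ψ>0 C j 5≤n n≤2^j 2^j≤2n M<ψ) n/φ≤s)
        (ceiling-≤ {n} {s n} {2 * (2 ^ a + 1)} {φ n} φ>0 K<φ s-1<n/φ)
        (half-bound (q₀ n) (n * 2 ^ (n ∸ s n)) {{N≢0}} close))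
    where
    5≤n : 5 ≤ n
    5≤n = ≤-trans (≤-trans (ℕ.m≤m+n 5 7) (ℕ.+-monoˡ-≤ 2 (ℕ.*-monoʳ-≤ 10 (0<2^ a)))) n≥₁
    n≢0 : NonZero n
    n≢0 = >-nonZero (≤-trans (s≤s z≤n) 5≤n)
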